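{- Let $A$ be a $\Sigma^{\mathcal P}$ sentence of the language of set theory (i.e. $A$ does not contain the relation symbol $\mathsf R$). If $\mathrm{KP}(\mathcal P)+\mathrm{GAC}\vdash A$, then $\mathrm{KP}(\mathcal P)+\mathrm{AC}\vdash A$.
   Context: Subset bounded quantifiers $\exists x\subseteq y\,\ldots$ and $\forall x\subseteq y\,\ldots$ abbreviate $\exists x(x\subseteq y\wedge\ldots)$ and $\forall x(x\subseteq y\to\ldots)$. The $\Delta_0^{\mathcal P}$-formulae form the smallest class containing the atomic formulae and closed under $\wedge,\vee,\to,\neg$ and the quantifiers $\forall x\in a$, $\exists x\in a$, $\forall x\subseteq a$, $\exists x\subseteq a$. The $\Sigma^{\mathcal P}$-formulae form the smallest class containing the $\Delta_0^{\mathcal P}$-formulae and closed under $\wedge,\vee$ and the quantifiers $\forall x\in a$, $\exists x\in a$, $\forall x\subseteq a$ and unbounded $\exists x$. Power Kripke–Platek set theory $\mathrm{KP}(\mathcal P)$ is the theory in the language of ZF with axioms: Extensionality, Pairing, Union, Infinity, Powerset, $\Delta_0^{\mathcal P}$-Separation ($\exists x\forall u[u\in x\leftrightarrow u\in a\wedge\varphi(u)]$ for $\Delta_0^{\mathcal P}$ $\varphi$), $\Delta_0^{\mathcal P}$-Collection ($\forall x\in a\,\exists y\,G(x,y)\to\exists z\,\forall x\in a\,\exists y\in z\,G(x,y)$ for $\Delta_0^{\mathcal P}$ $G$), and Set Induction for all formulae. $\mathrm{AC}$ is the axiom of choice. $\mathrm{KP}(\mathcal P)+\mathrm{GAC}$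 is the extension of $\mathrm{KP}(\mathcal P)$ to the language with a new binary relation symbol $\mathsf R$, where all axiom schemes of $\mathrm{KP}(\mathcal P)$ are extended to formulae of the richer language (so $\Delta_0^{\mathcal P}$ formulae may contain $\mathsf R$), together with the axioms $\forall x\forall y\forall z[\mathsf R(x,y)\wedge\mathsf R(x,z)\to y=z]$ and $\forall x[x\neq\emptyset\to\exists y\in x\,\mathsf R(x,y)]$. -}

module Defs where

open import Data.Nat using (ℕ; zero; suc)
open import Data.Fin using (Fin; zero; suc; #_)
open import Data.List using (List; []; _∷_; map)
open import Data.List.Membership.Propositional using (_∈_)
open import Data.List.Relation.Unary.All using (All)
open import Data.Product using (Σ; _×_)

data Lang : Set where
  ℒ∈ ℒR : Lang

-- First-order formulas, de Bruijn variables (Fin n = variables in scope).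
-- The language has no function symbols, so terms are variables.

infix  7 _∈̇_ _≐_ _⊆̇_
infixr 6 _∧̇_
infixr 5 _∨̇_
infixr 4 _⇒_ _⇔_

data Fm : Lang → ℕ → Set where
  _∈̇_ _≐_ : ∀ {L n} → Fin n → Fin n → Fm L n
  Ṙ        : ∀ {n} → Fin n → Fin n → Fm ℒR n
  _∧̇_ _∨̇_ _⇒_ : ∀ {L n} → Fm L n → Fm L n → Fm L n
  ¬̇        : ∀ {L n} → Fm L n → Fm L n
  ∀̇ ∃̇      : ∀ {L n} → Fm L (suc n) → Fm L n

Sentence : Lang → Set
Sentence L = Fm L 0

_⇔_ : ∀ {L n} → Fm L n → Fm L n → Fm L n
φ ⇔ ψ = (φ ⇒ ψ) ∧̇ (ψ ⇒ φ)

ext : ∀ {m n} → (Fin m → Fin n) → Fin (suc m) → Fin (suc n)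
ext ρ zero    = zero
ext ρ (suc i) = suc (ρ i)

ren : ∀ {L m n} → (Fin m → Fin n) → Fm L m → Fm L n
ren ρ (x ∈̇ y) = ρ x ∈̇ ρ y
ren ρ (x ≐ y) = ρ x ≐ ρ y
ren ρ (Ṙ x y) = Ṙ (ρ x) (ρ y)
ren ρ (φ ∧̇ ψ) = ren ρ φ ∧̇ ren ρ ψ
ren ρ (φ ∨̇ ψ) = ren ρ φ ∨̇ ren ρ ψ
ren ρ (φ ⇒ ψ) = ren ρ φ ⇒ ren ρ ψ
ren ρ (¬̇ φ)   = ¬̇ (ren ρ φ)
ren ρ (∀̇ φ)   = ∀̇ (ren (ext ρ) φ)
ren ρ (∃̇ φ)   = ∃̇ (ren (ext ρ) φ)

wk : ∀ {L n} → Fm L n → Fm L (suc n)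
wk = ren suc

inst₀ : ∀ {n} → Fin n → Fin (suc n) → Fin n
inst₀ t zero    = t
inst₀ t (suc i) = i

_[_] : ∀ {L n} → Fm L (suc n) → Fin n → Fm L n
φ [ t ] = ren (inst₀ t) φ

close : ∀ {L} n → Fm L n → Fm L 0
close zero    φ = φ
close (suc n) φ = close n (∀̇ φ)

embed : ∀ {n} → Fm ℒ∈ n → Fm ℒR n
embed (x ∈̇ y) = x ∈̇ y
embed (x ≐ y) = x ≐ y
embed (φ ∧̇ ψ) = embed φ ∧̇ embed ψ
embed (φ ∨̇ ψ) = embed φ ∨̇ embed ψ
embed (φ ⇒ ψ) = embed φ ⇒ embed ψ
embed (¬̇ φ)   = ¬̇ (embed φ)
embed (∀̇ φ)   = ∀̇ (embed φ)
embed (∃̇ φ)   = ∃̇ (embed φ)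

_⊆̇_ : ∀ {L n} → Fin n → Fin n → Fm L n
x ⊆̇ y = ∀̇ (zero ∈̇ suc x ⇒ zero ∈̇ suc y)

∀∈ ∃∈ ∀⊆ ∃⊆ : ∀ {L n} → Fin n → Fm L (suc n) → Fm L n
∀∈ a φ = ∀̇ (zero ∈̇ suc a ⇒ φ)
∃∈ a φ = ∃̇ (zero ∈̇ suc a ∧̇ φ)
∀⊆ a φ = ∀̇ (zero ⊆̇ suc a ⇒ φ)
∃⊆ a φ = ∃̇ (zero ⊆̇ suc a ∧̇ φ)

data Δ₀ᴾ : ∀ {L n} → Fm L n → Set where
  ∈-at  : ∀ {L n} (x y : Fin n) → Δ₀ᴾ {L} (x ∈̇ y)
  ≐-at  : ∀ {L n} (x y : Fin n) → Δ₀ᴾ {L} (x ≐ y)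
  R-at  : ∀ {n} (x y : Fin n) → Δ₀ᴾ (Ṙ x y)
  ∧-c   : ∀ {L n} {φ ψ : Fm L n} → Δ₀ᴾ φ → Δ₀ᴾ ψ → Δ₀ᴾ (φ ∧̇ ψ)
  ∨-c   : ∀ {L n} {φ ψ : Fm L n} → Δ₀ᴾ φ → Δ₀ᴾ ψ → Δ₀ᴾ (φ ∨̇ ψ)
  ⇒-c   : ∀ {L n} {φ ψ : Fm L n} → Δ₀ᴾ φ → Δ₀ᴾ ψ → Δ₀ᴾ (φ ⇒ ψ)
  ¬-c   : ∀ {L n} {φ : Fm L n} → Δ₀ᴾ φ → Δ₀ᴾ (¬̇ φ)
  ∀∈-c  : ∀ {L n} (a : Fin n) {φ : Fm L (suc n)} → Δ₀ᴾ φ → Δ₀ᴾ (∀∈ a φ)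
  ∃∈-c  : ∀ {L n} (a : Fin n) {φ : Fm L (suc n)} → Δ₀ᴾ φ → Δ₀ᴾ (∃∈ a φ)
  ∀⊆-c  : ∀ {L n} (a : Fin n) {φ : Fm L (suc n)} → Δ₀ᴾ φ → Δ₀ᴾ (∀⊆ a φ)
  ∃⊆-c  : ∀ {L n} (a : Fin n) {φ : Fm L (suc n)} → Δ₀ᴾ φ → Δ₀ᴾ (∃⊆ a φ)

data Σᴾ : ∀ {L n} → Fm L n → Set where
  Δ₀ᴾ⇒Σᴾ : ∀ {L n} {φ : Fm L n} → Δ₀ᴾ φ → Σᴾ φ
  ∧-c    : ∀ {L n} {φ ψ : Fm L n} → Σᴾ φ → Σᴾ ψ → Σᴾ (φ ∧̇ ψ)
  ∨-c    : ∀ {L n} {φ ψ : Fm L n} → Σᴾ φ → Σᴾ ψ → Σᴾ (φ ∨̇ ψ)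
  ∀∈-c   : ∀ {L n} (a : Fin n) {φ : Fm L (suc n)} → Σᴾ φ → Σᴾ (∀∈ a φ)
  ∃∈-c   : ∀ {L n} (a : Fin n) {φ : Fm L (suc n)} → Σᴾ φ → Σᴾ (∃∈ a φ)
  ∀⊆-c   : ∀ {L n} (a : Fin n) {φ : Fm L (suc n)} → Σᴾ φ → Σᴾ (∀⊆ a φ)
  ∃-c    : ∀ {L n} {φ : Fm L (suc n)} → Σᴾ φ → Σᴾ (∃̇ φ)

infix 2 _⊢_

data _⊢_ {L : Lang} {n : ℕ} (Γ : List (Fm L n)) : Fm L n → Set where
  hyp   : ∀ {φ} → φ ∈ Γ → Γ ⊢ φ
  ∧I    : ∀ {φ ψ} → Γ ⊢ φ → Γ ⊢ ψ → Γ ⊢ φ ∧̇ ψ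
  ∧E₁   : ∀ {φ ψ} → Γ ⊢ φ ∧̇ ψ → Γ ⊢ φ
  ∧E₂   : ∀ {φ ψ} → Γ ⊢ φ ∧̇ ψ → Γ ⊢ ψ
  ∨I₁   : ∀ {φ ψ} → Γ ⊢ φ → Γ ⊢ φ ∨̇ ψ
  ∨I₂   : ∀ {φ ψ} → Γ ⊢ ψ → Γ ⊢ φ ∨̇ ψ
  ∨E    : ∀ {φ ψ χ} → Γ ⊢ φ ∨̇ ψ → φ ∷ Γ ⊢ χ → ψ ∷ Γ ⊢ χ → Γ ⊢ χ
  ⇒I    : ∀ {φ ψ} → φ ∷ Γ ⊢ ψ → Γ ⊢ φ ⇒ ψ
  ⇒E    : ∀ {φ ψ} → Γ ⊢ φ ⇒ ψ → Γ ⊢ φ → Γ ⊢ ψ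
  ¬I    : ∀ {φ ψ} → φ ∷ Γ ⊢ ψ → φ ∷ Γ ⊢ ¬̇ ψ → Γ ⊢ ¬̇ φ
  ¬E    : ∀ {ψ χ} → Γ ⊢ ψ → Γ ⊢ ¬̇ ψ → Γ ⊢ χ
  ¬¬E   : ∀ {φ} → Γ ⊢ ¬̇ (¬̇ φ) → Γ ⊢ φ
  ∀I    : ∀ {φ} → map wk Γ ⊢ φ → Γ ⊢ ∀̇ φ
  ∀E    : ∀ {φ} → Γ ⊢ ∀̇ φ → (t : Fin n) → Γ ⊢ φ [ t ]
  ∃I    : ∀ {φ} (t : Fin n) → Γ ⊢ φ [ t ] → Γ ⊢ ∃̇ φ
  ∃E    : ∀ {φ χ} → Γ ⊢ ∃̇ φ → φ ∷ map wk Γ ⊢ wk χ → Γ ⊢ χ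
  -- the domain of discourse is nonempty (standard first-order logic)
  nonempty : Γ ⊢ ∃̇ (zero ≐ zero)
  ≐refl : (t : Fin n) → Γ ⊢ t ≐ t
  ≐E    : ∀ {φ s t} → Γ ⊢ s ≐ t → Γ ⊢ φ [ s ] → Γ ⊢ φ [ t ]

Theory : Lang → Set₁
Theory L = Sentence L → Set

infix 2 _⊩_
_⊩_ : ∀ {L} → Theory L → Sentence L → Set
T ⊩ A = Σ (List (Sentence _)) λ Γ → All T Γ × (Γ ⊢ A)

extAx pairAx unionAx infAx powAx : ∀ {L} → Sentence L
extAx   = ∀̇ (∀̇ (∀̇ (# 0 ∈̇ # 2 ⇔ # 0 ∈̇ # 1) ⇒ # 1 ≐ # 0))
pairAx  = ∀̇ (∀̇ (∃̇ (# 2 ∈̇ # 0 ∧̇ # 1 ∈̇ # 0)))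
unionAx = ∀̇ (∃̇ (∀∈ (# 1) (∀∈ (# 0) (# 0 ∈̇ # 2))))
infAx   = ∃̇ (∃̇ (# 0 ∈̇ # 1) ∧̇ ∀∈ (# 0) (∃∈ (# 1) (# 1 ∈̇ # 0)))
powAx   = ∀̇ (∃̇ (∀̇ (# 0 ⊆̇ # 2 ⇒ # 0 ∈̇ # 1)))

-- Separation instance.  φ : variables  0 = u, 1 = a, 2.. = parameters.
-- ∀params ∀a ∃x ∀u (u ∈ x ↔ u ∈ a ∧ φ(u, a, params))
sepAx : ∀ {L} n → Fm L (suc (suc n)) → Sentence L
sepAx n φ = close (suc n) (∃̇ (∀̇ (# 0 ∈̇ # 1 ⇔ (# 0 ∈̇ # 2 ∧̇ ren (ext suc) φ))))

-- Collection instance.  G : variables 0 = y, 1 = x, 2 = a, 3.. = parameters.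
-- ∀params ∀a [∀x∈a ∃y G → ∃z ∀x∈a ∃y∈z G]
collAx : ∀ {L} n → Fm L (suc (suc (suc n))) → Sentence L
collAx n G = close (suc n)
  (∀∈ (# 0) (∃̇ G) ⇒ ∃̇ (∀∈ (# 1) (∃∈ (# 1) (ren (ext (ext suc)) G))))

-- Set induction instance.  φ : variables 0 = the induction variable, 1.. = params.
-- ∀params [∀a (∀x∈a φ(x) → φ(a)) → ∀a φ(a)]
indAx : ∀ {L} n → Fm L (suc n) → Sentence L
indAx n φ = close n (∀̇ (∀∈ (# 0) (ren (ext suc) φ) ⇒ φ) ⇒ ∀̇ φ)

data KPᴾ {L : Lang} : Theory L where
  extensionality : KPᴾ extAx
  pair  : KPᴾ pairAx
  union : KPᴾ unionAx
  inf   : KPᴾ infAx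
  pow   : KPᴾ powAx
  sep   : ∀ n (φ : Fm L (suc (suc n))) → Δ₀ᴾ φ → KPᴾ (sepAx n φ)
  coll  : ∀ n (G : Fm L (suc (suc (suc n)))) → Δ₀ᴾ G → KPᴾ (collAx n G)
  ind   : ∀ n (φ : Fm L (suc n)) → KPᴾ (indAx n φ)

isSing : ∀ {L n} → Fin n → Fin n → Fm L n
isSing u y = ∀̇ (# 0 ∈̇ suc u ⇔ # 0 ≐ suc y)

isDoub : ∀ {L n} → Fin n → Fin n → Fin n → Fm L n
isDoub u y z = ∀̇ (# 0 ∈̇ suc u ⇔ (# 0 ≐ suc y ∨̇ # 0 ≐ suc z))

isOPair : ∀ {L n} → Fin n → Fin n → Fin n → Fm L n
isOPair p y z = ∀̇ (# 0 ∈̇ suc p ⇔ (isSing (# 0) (suc y) ∨̇ isDoub (# 0) (suc y) (suc z)))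

pairIn : ∀ {L n} → Fin n → Fin n → Fin n → Fm L n
pairIn y z f = ∃∈ f (isOPair (# 0) (suc y) (suc z))

acAx : ∀ {L} → Sentence L
acAx = ∀̇ (∀∈ (# 0) (∃̇ (# 0 ∈̇ # 1))
          ⇒ ∃̇ (∀∈ (# 1) (∃∈ (# 0)
                 (pairIn (# 1) (# 0) (# 2) ∧̇ ∀̇ (pairIn (# 2) (# 0) (# 3) ⇒ # 0 ≐ # 1)))))

gacFunAx gacChoiceAx : Sentence ℒR
gacFunAx    = ∀̇ (∀̇ (∀̇ (Ṙ (# 2) (# 1) ∧̇ Ṙ (# 2) (# 0) ⇒ # 1 ≐ # 0)))
gacChoiceAx = ∀̇ (¬̇ (∀̇ (¬̇ (# 0 ∈̇ # 1))) ⇒ ∃∈ (# 0) (Ṙ (# 1) (# 0)))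

data KPᴾ+AC : Theory ℒ∈ where
  kp : ∀ {A} → KPᴾ A → KPᴾ+AC A
  ac : KPᴾ+AC acAx

data KPᴾ+GAC : Theory ℒR where
  kp     : ∀ {A} → KPᴾ A → KPᴾ+GAC A
  gacFun : KPᴾ+GAC gacFunAx
  gacCh  : KPᴾ+GAC gacChoiceAx

{-# OPTIONS --safe #-}
module Submission where

open import Defs
open import Data.Empty using (⊥-elim)
open import Data.Fin using (#_; Fin; suc; toℕ; zero)
open import Data.List using (List; []; _++_; _∷_; allFin; cartesianProductWith; map)
open import Data.List.Membership.Propositional using (_∈_)
open import Data.List.Membership.Propositional.Properties
  using (∈-++⁺ʳ; ∈-++⁺ˡ; ∈-allFin; ∈-cartesianProductWith⁺; ∈-map⁺; ∈-map⁻)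
open import Data.List.Relation.Unary.All as All using (All; []; _∷_)
open import Data.List.Relation.Unary.All.Properties as AllP using ()
open import Data.List.Relation.Unary.Any using (here; there)
open import Data.Nat using (_+_; _∸_; _≤?_; _≤_; _⊔_; suc; s≤s; zero; z≤n; ℕ)
open import Data.Nat.Properties
  using (+-identityʳ; +-suc; <⇒≱; m∸n+n≡m; m≤m+n; m≤m⊔n; m≤n+m; m≤n⇒m<n∨m≡n; m≤n⇒m≤1+n; m≤n⊔m; n<1+n; ≤-pred; ≤-refl; ≤-trans)
open import Data.Product using (_,_; _×_; proj₁; proj₂; Σ)
open import Data.Sum using (_⊎_; inj₁; inj₂)
open import Function using (_∘_; id)
open import Relation.Binary.PropositionalEquality using (_≡_; cong; cong₂; refl; subst; sym; trans)
open import Relation.Nullary using (no; yes)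

-- By completeness, argue in a model of KP(𝒫) + AC and force a global choice function without adding
-- sets. A condition ⟨ s , r , w ⟩ fixes the choice function on a nice (transitive and ⊆-closed) set s
-- and makes a set w of promises of the form "there is no y with G(x, y)", where G runs over the
-- finitely many Δ₀ᴾ formulas used in collection axioms; it must extend to every larger nice set.
-- The promises make collection true generically: if the condition forces ∀ x ∈ a ∃ y G(x, y), then
-- promising that some x ∈ a has no y is not consistent, so for each x ∈ a some nice set sₓ admits
-- no choice function keeping that promise; collection in the ground model bounds all sₓ by one nice
-- set, which then contains the required y. Conditions extend to larger nice sets by a pigeonhole
-- argument on the power set, so no transfinite recursion enters.

-- The obstacle is collection. Being a condition quantifies over all larger nice sets, so that "p
-- forces ∃ y G" is no Δ₀ᴾ statement and the witnesses y cannot be collected directly. Failing to be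
-- a condition, by contrast, is existential with a Δ₀ᴾ matrix, and witnesses of such failures can be
-- collected. Promises turn one into the other: when the absence of a witness is part of a point,
-- the presence of a witness becomes the failure of a condition. For the matrix to be Δ₀ᴾ, the
-- choice relations on s must range over the subsets of a given set; hence the second nice set `U`
-- in `Cond`, and the coding of a pair by a subset of s. All promises must come from one formula
-- fixed in advance, so that forcing is definable, as set induction requires; the collection axioms
-- of the given derivation are therefore merged into one `Template`.

-- Renaming of variables

ext-cong : ∀ {m n} {ρ σ : Fin m → Fin n} → (∀ i → ρ i ≡ σ i) → ∀ i → ext ρ i ≡ ext σ i
ext-cong h zero    = refl
ext-cong h (suc i) = cong suc (h i)

ren-cong : ∀ {L m n} {ρ σ : Fin m → Fin n} → (∀ i → ρ i ≡ σ i) → (φ : Fm L m) → ren ρ φ ≡ ren σ φ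
ren-cong h (x ∈̇ y) = cong₂ _∈̇_ (h x) (h y)
ren-cong h (x ≐ y) = cong₂ _≐_ (h x) (h y)
ren-cong h (Ṙ x y) = cong₂ Ṙ (h x) (h y)
ren-cong h (φ ∧̇ ψ) = cong₂ _∧̇_ (ren-cong h φ) (ren-cong h ψ)
ren-cong h (φ ∨̇ ψ) = cong₂ _∨̇_ (ren-cong h φ) (ren-cong h ψ)
ren-cong h (φ ⇒ ψ) = cong₂ _⇒_ (ren-cong h φ) (ren-cong h ψ)
ren-cong h (¬̇ φ)   = cong ¬̇ (ren-cong h φ)
ren-cong h (∀̇ φ)   = cong ∀̇ (ren-cong (ext-cong h) φ)
ren-cong h (∃̇ φ)   = cong ∃̇ (ren-cong (ext-cong h) φ)

ext-id : ∀ {n} {ρ : Fin n → Fin n} → (∀ i → ρ i ≡ i) → ∀ i → ext ρ i ≡ i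
ext-id h zero    = refl
ext-id h (suc i) = cong suc (h i)

ren-id : ∀ {L n} {ρ : Fin n → Fin n} → (∀ i → ρ i ≡ i) → (φ : Fm L n) → ren ρ φ ≡ φ
ren-id h (x ∈̇ y) = cong₂ _∈̇_ (h x) (h y)
ren-id h (x ≐ y) = cong₂ _≐_ (h x) (h y)
ren-id h (Ṙ x y) = cong₂ Ṙ (h x) (h y)
ren-id h (φ ∧̇ ψ) = cong₂ _∧̇_ (ren-id h φ) (ren-id h ψ)
ren-id h (φ ∨̇ ψ) = cong₂ _∨̇_ (ren-id h φ) (ren-id h ψ)
ren-id h (φ ⇒ ψ) = cong₂ _⇒_ (ren-id h φ) (ren-id h ψ)
ren-id h (¬̇ φ)   = cong ¬̇ (ren-id h φ)
ren-id h (∀̇ φ)   = cong ∀̇ (ren-id (ext-id h) φ)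
ren-id h (∃̇ φ)   = cong ∃̇ (ren-id (ext-id h) φ)

ext-∘ : ∀ {l m n} {ρ : Fin m → Fin n} {σ : Fin l → Fin m} {τ : Fin l → Fin n} →
        (∀ i → ρ (σ i) ≡ τ i) → ∀ i → ext ρ (ext σ i) ≡ ext τ i
ext-∘ h zero    = refl
ext-∘ h (suc i) = cong suc (h i)

ren-∘ : ∀ {L l m n} {ρ : Fin m → Fin n} {σ : Fin l → Fin m} {τ : Fin l → Fin n} →
        (∀ i → ρ (σ i) ≡ τ i) → (φ : Fm L l) → ren ρ (ren σ φ) ≡ ren τ φ
ren-∘ h (x ∈̇ y) = cong₂ _∈̇_ (h x) (h y)
ren-∘ h (x ≐ y) = cong₂ _≐_ (h x) (h y)
ren-∘ h (Ṙ x y) = cong₂ Ṙ (h x) (h y)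
ren-∘ h (φ ∧̇ ψ) = cong₂ _∧̇_ (ren-∘ h φ) (ren-∘ h ψ)
ren-∘ h (φ ∨̇ ψ) = cong₂ _∨̇_ (ren-∘ h φ) (ren-∘ h ψ)
ren-∘ h (φ ⇒ ψ) = cong₂ _⇒_ (ren-∘ h φ) (ren-∘ h ψ)
ren-∘ h (¬̇ φ)   = cong ¬̇ (ren-∘ h φ)
ren-∘ h (∀̇ φ)   = cong ∀̇ (ren-∘ (ext-∘ h) φ)
ren-∘ h (∃̇ φ)   = cong ∃̇ (ren-∘ (ext-∘ h) φ)

ren-square : ∀ {L l m m′ n} {ρ : Fin m → Fin n} {σ : Fin l → Fin m} {ρ′ : Fin m′ → Fin n} {σ′ : Fin l → Fin m′} →
             (∀ i → ρ (σ i) ≡ ρ′ (σ′ i)) → (φ : Fm L l) → ren ρ (ren σ φ) ≡ ren ρ′ (ren σ′ φ)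
ren-square h φ = trans (ren-∘ h φ) (sym (ren-∘ (λ _ → refl) φ))

ren-wk : ∀ {L m n} (σ : Fin m → Fin n) (φ : Fm L m) → ren (ext σ) (wk φ) ≡ wk (ren σ φ)
ren-wk σ = ren-square λ _ → refl

ren-inst : ∀ {L m n} (σ : Fin m → Fin n) (φ : Fm L (suc m)) (t : Fin m) →
           ren σ (φ [ t ]) ≡ ren (ext σ) φ [ σ t ]
ren-inst σ φ t = ren-square (λ { zero → refl ; (suc i) → refl }) φ

wk-inst : ∀ {L n} (φ : Fm L n) (t : Fin n) → wk φ [ t ] ≡ φ
wk-inst φ t = trans (ren-∘ {τ = id} (λ _ → refl) φ) (ren-id (λ _ → refl) φ)

ext-suc-inst : ∀ {L n} (φ : Fm L (suc n)) → ren (ext suc) φ [ zero ] ≡ φ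
ext-suc-inst φ = trans (ren-∘ {τ = id} (λ { zero → refl ; (suc i) → refl }) φ) (ren-id (λ _ → refl) φ)

-- Renaming and weakening of derivations

⊢-≡ : ∀ {L n} {Γ : List (Fm L n)} {φ ψ} → φ ≡ ψ → Γ ⊢ φ → Γ ⊢ ψ
⊢-≡ refl d = d

lift-hyps : ∀ {L m n} {Γ : List (Fm L m)} {Δ : List (Fm L n)} {f : Fm L m → Fm L n} (χ : Fm L m) →
            (∀ {ψ} → ψ ∈ Γ → f ψ ∈ Δ) → ∀ {ψ} → ψ ∈ χ ∷ Γ → f ψ ∈ f χ ∷ Δ
lift-hyps χ h (here refl) = here refl
lift-hyps χ h (there i)   = there (h i)

wk-hyps : ∀ {L m n} {Γ : List (Fm L m)} {Δ : List (Fm L n)} (σ : Fin m → Fin n) →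
          (∀ {ψ} → ψ ∈ Γ → ren σ ψ ∈ Δ) → ∀ {ψ} → ψ ∈ map wk Γ → ren (ext σ) ψ ∈ map wk Δ
wk-hyps {Δ = Δ} σ h i with ∈-map⁻ wk i
... | ψ , j , refl = subst (_∈ map wk Δ) (sym (ren-wk σ ψ)) (∈-map⁺ wk (h j))

⊢-ren : ∀ {L m n} {Γ : List (Fm L m)} {Δ : List (Fm L n)} (σ : Fin m → Fin n) →
        (∀ {ψ} → ψ ∈ Γ → ren σ ψ ∈ Δ) → ∀ {φ} → Γ ⊢ φ → Δ ⊢ ren σ φ
⊢-ren σ h (hyp i)      = hyp (h i)
⊢-ren σ h (∧I d e)     = ∧I (⊢-ren σ h d) (⊢-ren σ h e)
⊢-ren σ h (∧E₁ d)      = ∧E₁ (⊢-ren σ h d)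
⊢-ren σ h (∧E₂ d)      = ∧E₂ (⊢-ren σ h d)
⊢-ren σ h (∨I₁ d)      = ∨I₁ (⊢-ren σ h d)
⊢-ren σ h (∨I₂ d)      = ∨I₂ (⊢-ren σ h d)
⊢-ren σ h (∨E d e f)   = ∨E (⊢-ren σ h d) (⊢-ren σ (lift-hyps _ h) e) (⊢-ren σ (lift-hyps _ h) f)
⊢-ren σ h (⇒I d)       = ⇒I (⊢-ren σ (lift-hyps _ h) d)
⊢-ren σ h (⇒E d e)     = ⇒E (⊢-ren σ h d) (⊢-ren σ h e)
⊢-ren σ h (¬I d e)     = ¬I (⊢-ren σ (lift-hyps _ h) d) (⊢-ren σ (lift-hyps _ h) e)
⊢-ren σ h (¬E d e)     = ¬E (⊢-ren σ h d) (⊢-ren σ h e)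
⊢-ren σ h (¬¬E d)      = ¬¬E (⊢-ren σ h d)
⊢-ren σ h (∀I d)       = ∀I (⊢-ren (ext σ) (wk-hyps σ h) d)
⊢-ren σ h (∀E {φ} d t) = ⊢-≡ (sym (ren-inst σ φ t)) (∀E (⊢-ren σ h d) (σ t))
⊢-ren σ h (∃I {φ} t d) = ∃I (σ t) (⊢-≡ (ren-inst σ φ t) (⊢-ren σ h d))
⊢-ren σ h (∃E {φ} {χ} d e) =
  ∃E (⊢-ren σ h d) (⊢-≡ (ren-wk σ χ) (⊢-ren (ext σ) (lift-hyps φ (wk-hyps σ h)) e))
⊢-ren σ h nonempty     = nonempty
⊢-ren σ h (≐refl t)    = ≐refl (σ t)
⊢-ren σ h (≐E {φ} {s} {t} d e) =
  ⊢-≡ (sym (ren-inst σ φ t))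
    (≐E {φ = ren (ext σ) φ} (⊢-ren σ h d) (⊢-≡ (ren-inst σ φ s) (⊢-ren σ h e)))

⊢-weaken : ∀ {L n} {Γ Δ : List (Fm L n)} → (∀ {ψ} → ψ ∈ Γ → ψ ∈ Δ) → ∀ {φ} → Γ ⊢ φ → Δ ⊢ φ
⊢-weaken {Δ = Δ} h {φ} d =
  ⊢-≡ (ren-id (λ _ → refl) φ)
    (⊢-ren id (λ {ψ} i → subst (_∈ Δ) (sym (ren-id (λ _ → refl) ψ)) (h i)) d)

-- The language has no constant for falsity; the negation of a provable formula serves.
⊥̇ : ∀ {L n} → Fm L n
⊥̇ = ¬̇ (∀̇ (zero ≐ zero))

⊥̇E : ∀ {L n} {Γ : List (Fm L n)} {φ} → Γ ⊢ ⊥̇ → Γ ⊢ φ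
⊥̇E d = ¬E (∀I (≐refl zero)) d

-- Derivability from possibly infinite sets of hypotheses

infix 2 _⊢∞_
_⊢∞_ : ∀ {L n} → (Fm L n → Set) → Fm L n → Set
P ⊢∞ φ = Σ (List _) λ Γ → All P Γ × (Γ ⊢ φ)

ax∞ : ∀ {L n} {P : Fm L n → Set} {φ} → P φ → P ⊢∞ φ
ax∞ p = _ ∷ [] , p ∷ [] , hyp (here refl)

⊢∞-mono : ∀ {L n} {P Q : Fm L n → Set} → (∀ {ψ} → P ψ → Q ψ) → ∀ {φ} → P ⊢∞ φ → Q ⊢∞ φ
⊢∞-mono h (Γ , ps , d) = Γ , All.map h ps , d

⊢∞-cut : ∀ {L n} {P : Fm L n → Set} (Γ : List (Fm L n)) → All (P ⊢∞_) Γ → ∀ {φ} → Γ ⊢ φ → P ⊢∞ φ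
⊢∞-cut []      []       d = [] , [] , d
⊢∞-cut (ψ ∷ Γ) (p ∷ ps) d with ⊢∞-cut Γ ps (⇒I d) | p
... | Δ , qs , e | Δ′ , qs′ , e′ =
  Δ ++ Δ′ , AllP.++⁺ qs qs′ , ⇒E (⊢-weaken ∈-++⁺ˡ e) (⊢-weaken (∈-++⁺ʳ Δ) e′)

data _⊕_ {L n} (P : Fm L n → Set) (φ : Fm L n) : Fm L n → Set where
  old : ∀ {ψ} → P ψ → (P ⊕ φ) ψ
  new : (P ⊕ φ) φ

⊢∞-deduction : ∀ {L n} {P : Fm L n → Set} {φ ψ} → P ⊕ φ ⊢∞ ψ → P ⊢∞ φ ⇒ ψ
⊢∞-deduction {P = P} {φ} (Γ , ps , d) with strip Γ ps
  where
  strip : ∀ Γ → All (P ⊕ φ) Γ → Σ (List _) λ Δ → All P Δ × (∀ {χ} → χ ∈ Γ → χ ∈ φ ∷ Δ)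
  strip []      []           = [] , [] , λ ()
  strip (χ ∷ Γ) (p ∷ ps) with strip Γ ps
  strip (χ ∷ Γ) (old p ∷ ps) | Δ , qs , h = χ ∷ Δ , p ∷ qs , λ
    { (here refl) → there (here refl)
    ; (there i)   → swap (h i) }
    where
    swap : ∀ {ξ} → ξ ∈ φ ∷ Δ → ξ ∈ φ ∷ χ ∷ Δ
    swap (here e)  = here e
    swap (there i) = there (there i)
  strip (χ ∷ Γ) (new ∷ ps)   | Δ , qs , h = Δ , qs , λ
    { (here refl) → here refl
    ; (there i)   → h i }
... | Δ , qs , h = Δ , qs , ⇒I (⊢-weaken h d)

⊢∞-¬I : ∀ {L n} {P : Fm L n → Set} {φ} → P ⊕ φ ⊢∞ ⊥̇ → P ⊢∞ ¬̇ φ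
⊢∞-¬I {φ = φ} p = ⊢∞-cut (_ ∷ []) (⊢∞-deduction p ∷ [])
  (¬I {ψ = ⊥̇} (⇒E (hyp (there (here refl))) (hyp (here refl)))
      (⊥̇E (⇒E (hyp (there (here refl))) (hyp (here refl)))))

data Wk {L n} (P : Fm L n → Set) : Fm L (suc n) → Set where
  wk∈ : ∀ {φ} → P φ → Wk P (wk φ)

⊢∞-wk : ∀ {L n} {P : Fm L n → Set} {φ} → P ⊢∞ φ → Wk P ⊢∞ wk φ
⊢∞-wk (Γ , ps , d) = map wk Γ , AllP.map⁺ (All.map wk∈ ps) , ⊢-ren suc (∈-map⁺ wk) d

⊢∞-unwk : ∀ {L n} {P : Fm L n → Set} {φ : Fm L (suc n)} → Wk P ⊢∞ φ →
          Σ (List (Fm L n)) λ Γ → All P Γ × (map wk Γ ⊢ φ)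
⊢∞-unwk {P = P} (Δ , ps , d) with go Δ ps
  where
  go : ∀ Δ → All (Wk P) Δ → Σ (List _) λ Γ → All P Γ × (Δ ≡ map wk Γ)
  go []      []           = [] , [] , refl
  go (_ ∷ Δ) (wk∈ p ∷ ps) with go Δ ps
  ... | Γ , qs , refl = _ ∷ Γ , p ∷ qs , refl
... | Γ , qs , refl = Γ , qs , d

henkin : ∀ {L n} → Fm L (suc n) → Fm L (suc n)
henkin φ = wk (∃̇ φ) ⇒ φ

-- A refutation of the axiom proves `∃̇ φ` and also, for the fresh variable, `¬̇ φ`; ∃-elimination
-- with that variable yields the contradiction.
henkin-conservative : ∀ {L n} {P : Fm L (suc n) → Set} {φ} → Wk P ⊕ henkin φ ⊢∞ ⊥̇ → P ⊢∞ ⊥̇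
henkin-conservative {φ = φ} p with ⊢∞-unwk (⊢∞-¬I p)
... | Γ , ps , d = Γ , ps , ∃E exists (¬E (⇒I (hyp (there (here refl)))) (⊢-weaken there d))
  where
  exists : Γ ⊢ ∃̇ φ
  -- The derivation has the fresh variable in scope, although `∃̇ φ` does not mention it. Some other
  -- variable is always available, so `zero` can be put in its place.
  exists = ⊢-≡ (wk-inst (∃̇ φ) zero)
    (∀E (∀I (¬¬E (¬I (⇒I (⊥̇E (¬E (hyp (here refl)) (hyp (there (here refl))))))
                     (⊢-weaken there d)))) zero)

-- Enumeration of formulas

depth : ∀ {n} → Fm ℒ∈ n → ℕ
depth (x ∈̇ y) = 1
depth (x ≐ y) = 1
depth (φ ∧̇ ψ) = suc (depth φ ⊔ depth ψ)
depth (φ ∨̇ ψ) = suc (depth φ ⊔ depth ψ)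
depth (φ ⇒ ψ) = suc (depth φ ⊔ depth ψ)
depth (¬̇ φ)   = suc (depth φ)
depth (∀̇ φ)   = suc (depth φ)
depth (∃̇ φ)   = suc (depth φ)

depth-ren : ∀ {m n} (σ : Fin m → Fin n) (φ : Fm ℒ∈ m) → depth (ren σ φ) ≡ depth φ
depth-ren σ (x ∈̇ y) = refl
depth-ren σ (x ≐ y) = refl
depth-ren σ (φ ∧̇ ψ) = cong₂ (λ a b → suc (a ⊔ b)) (depth-ren σ φ) (depth-ren σ ψ)
depth-ren σ (φ ∨̇ ψ) = cong₂ (λ a b → suc (a ⊔ b)) (depth-ren σ φ) (depth-ren σ ψ)
depth-ren σ (φ ⇒ ψ) = cong₂ (λ a b → suc (a ⊔ b)) (depth-ren σ φ) (depth-ren σ ψ)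
depth-ren σ (¬̇ φ)   = cong suc (depth-ren σ φ)
depth-ren σ (∀̇ φ)   = cong suc (depth-ren (ext σ) φ)
depth-ren σ (∃̇ φ)   = cong suc (depth-ren (ext σ) φ)

formulas : ℕ → ∀ n → List (Fm ℒ∈ n)
formulas zero    n = []
formulas (suc d) n =
  cartesianProductWith _∈̇_ (allFin n) (allFin n) ++
  cartesianProductWith _≐_ (allFin n) (allFin n) ++
  cartesianProductWith _∧̇_ (formulas d n) (formulas d n) ++
  cartesianProductWith _∨̇_ (formulas d n) (formulas d n) ++
  cartesianProductWith _⇒_ (formulas d n) (formulas d n) ++
  map ¬̇ (formulas d n) ++
  map ∀̇ (formulas d (suc n)) ++
  map ∃̇ (formulas d (suc n))

∈-formulas : ∀ {d n} (φ : Fm ℒ∈ n) → depth φ ≤ d → φ ∈ formulas d n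
∈-formulas {suc d} {n} φ h = go φ h
  where
  in-allFin = ∈-allFin {n}
  left : ∀ {a b} → suc (a ⊔ b) ≤ suc d → a ≤ d
  left p = ≤-trans (m≤m⊔n _ _) (≤-pred p)
  right : ∀ {a b} → suc (a ⊔ b) ≤ suc d → b ≤ d
  right {a} p = ≤-trans (m≤n⊔m a _) (≤-pred p)
  s₁ : ∀ {v ys} → v ∈ ys → v ∈ cartesianProductWith _∈̇_ (allFin n) (allFin n) ++ ys
  s₁ = ∈-++⁺ʳ (cartesianProductWith _∈̇_ (allFin n) (allFin n))
  s₂ : ∀ {v ys} → v ∈ ys → v ∈ cartesianProductWith _≐_ (allFin n) (allFin n) ++ ys
  s₂ = ∈-++⁺ʳ (cartesianProductWith _≐_ (allFin n) (allFin n))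
  s₃ : ∀ {v ys} → v ∈ ys → v ∈ cartesianProductWith _∧̇_ (formulas d n) (formulas d n) ++ ys
  s₃ = ∈-++⁺ʳ (cartesianProductWith _∧̇_ (formulas d n) (formulas d n))
  s₄ : ∀ {v ys} → v ∈ ys → v ∈ cartesianProductWith _∨̇_ (formulas d n) (formulas d n) ++ ys
  s₄ = ∈-++⁺ʳ (cartesianProductWith _∨̇_ (formulas d n) (formulas d n))
  s₅ : ∀ {v ys} → v ∈ ys → v ∈ cartesianProductWith _⇒_ (formulas d n) (formulas d n) ++ ys
  s₅ = ∈-++⁺ʳ (cartesianProductWith _⇒_ (formulas d n) (formulas d n))
  s₆ : ∀ {v ys} → v ∈ ys → v ∈ map ¬̇ (formulas d n) ++ ys
  s₆ = ∈-++⁺ʳ (map ¬̇ (formulas d n))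
  s₇ : ∀ {v ys} → v ∈ ys → v ∈ map ∀̇ (formulas d (suc n)) ++ ys
  s₇ = ∈-++⁺ʳ (map ∀̇ (formulas d (suc n)))
  go : (φ : Fm ℒ∈ n) → depth φ ≤ suc d → φ ∈ formulas (suc d) n
  go (x ∈̇ y) p = ∈-++⁺ˡ (∈-cartesianProductWith⁺ _∈̇_ (in-allFin x) (in-allFin y))
  go (x ≐ y) p = s₁ (∈-++⁺ˡ (∈-cartesianProductWith⁺ _≐_ (in-allFin x) (in-allFin y)))
  go (φ ∧̇ ψ) p = s₁ (s₂ (∈-++⁺ˡ (∈-cartesianProductWith⁺ _∧̇_ (∈-formulas φ (left p)) (∈-formulas ψ (right {depth φ} p)))))
  go (φ ∨̇ ψ) p = s₁ (s₂ (s₃ (∈-++⁺ˡ (∈-cartesianProductWith⁺ _∨̇_ (∈-formulas φ (left p)) (∈-formulas ψ (right {depth φ} p))))))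
  go (φ ⇒ ψ) p = s₁ (s₂ (s₃ (s₄ (∈-++⁺ˡ (∈-cartesianProductWith⁺ _⇒_ (∈-formulas φ (left p)) (∈-formulas ψ (right {depth φ} p)))))))
  go (¬̇ φ)   p = s₁ (s₂ (s₃ (s₄ (s₅ (∈-++⁺ˡ (∈-map⁺ ¬̇ (∈-formulas φ (≤-pred p))))))))
  go (∀̇ φ)   p = s₁ (s₂ (s₃ (s₄ (s₅ (s₆ (∈-++⁺ˡ (∈-map⁺ ∀̇ (∈-formulas φ (≤-pred p)))))))))
  go (∃̇ φ)   p = s₁ (s₂ (s₃ (s₄ (s₅ (s₆ (s₇ (∈-map⁺ ∃̇ (∈-formulas φ (≤-pred p)))))))))
∈-formulas {zero} (x ∈̇ y) ()
∈-formulas {zero} (x ≐ y) ()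

-- Enumeration of pairs, and parameters of the stages

-- Successor in Cantor's enumeration of pairs along antidiagonals.
step : ℕ × ℕ → ℕ × ℕ
step (a , zero)  = zero , suc a
step (a , suc b) = suc a , b

unpair : ℕ → ℕ × ℕ
unpair zero    = zero , zero
unpair (suc n) = step (unpair n)

unpair-surjective : ∀ a b → Σ ℕ λ n → unpair n ≡ (a , b)
unpair-surjective = λ a b → walk a b (start (a + b))
  where
  Reached : ℕ → ℕ → Set
  Reached a b = Σ ℕ λ n → unpair n ≡ (a , b)
  next : ∀ {a b} → Reached a (suc b) → Reached (suc a) b
  next (n , e) = suc n , cong step e
  walk : ∀ a b → Reached 0 (a + b) → Reached a b
  walk zero    b r = r
  walk (suc a) b r = next (walk a (suc b) (subst (Reached 0) (sym (+-suc a b)) r))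
  start : ∀ s → Reached 0 s
  start zero    = 0 , refl
  start (suc s) with walk s 0 (subst (Reached 0) (sym (+-identityʳ s)) (start s))
  ... | n , e = suc n , cong step e

-- Ensures that an item with index `K` is handled at a stage `N` with `K ≤ N`, when the parameters
-- up to `K` are in scope.
unpair-≤ : ∀ n → proj₁ (unpair n) ≤ n
unpair-≤ n = ≤-trans (m≤m+n _ _) (bound n)
  where
  step-bound : ∀ {n} p → proj₁ p + proj₂ p ≤ n → proj₁ (step p) + proj₂ (step p) ≤ suc n
  step-bound (a , zero)  h = s≤s (subst (_≤ _) (+-identityʳ a) h)
  step-bound {n} (a , suc b) h = m≤n⇒m≤1+n (subst (_≤ n) (+-suc a b) h)
  bound : ∀ n → proj₁ (unpair n) + proj₂ (unpair n) ≤ n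
  bound zero    = z≤n
  bound (suc n) = step-bound (unpair n) (bound n)

nth : ∀ {A : Set} → A → List A → ℕ → A
nth a []       n       = a
nth a (x ∷ xs) zero    = x
nth a (x ∷ xs) (suc n) = nth a xs n

nth-∈ : ∀ {A : Set} {a x : A} {xs} → x ∈ xs → Σ ℕ λ n → nth a xs n ≡ x
nth-∈ (here refl) = 0 , refl
nth-∈ (there i)   with nth-∈ i
... | n , e = suc n , e

-- The parameter d : ℕ is, at stage N, a de Bruijn variable counted from the outside, so that it is
-- stable under wk.
var : ∀ N → ℕ → Fin (suc N)
var zero    d = zero
var (suc N) d with d ≤? N
... | yes _ = suc (var N d)
... | no  _ = zero

var-suc : ∀ {N d} → d ≤ N → suc (var N d) ≡ var (suc N) d
var-suc {N} {d} h with d ≤? N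
... | yes _ = refl
... | no ¬h = ⊥-elim (¬h h)

var-last : ∀ N → zero ≡ var (suc N) (suc N)
var-last N with suc N ≤? N
... | yes h = ⊥-elim (<⇒≱ (n<1+n N) h)
... | no  _ = refl

level : ∀ {N} → Fin (suc N) → ℕ
level {N} i = N ∸ toℕ i

level-var : ∀ N {d} → d ≤ N → level (var N d) ≡ d
level-var zero    z≤n = refl
level-var (suc N) {d} h with d ≤? N
... | yes h′ = level-var N h′
... | no ¬h′ with m≤n⇒m<n∨m≡n h
...   | inj₁ (s≤s h″) = ⊥-elim (¬h′ h″)
...   | inj₂ refl     = refl

-- One list of formulas serves two purposes: `transport₁` reads the variables as a bound variable
-- and the parameters 0 to `K`, `transport₀` reads them as the parameters 0 to `suc K`.
Item : Set
Item = Σ ℕ λ K → Fm ℒ∈ (suc (suc K))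

item : ℕ → Item
item N with unpair N
... | K , j = K , nth ⊥̇ (formulas K (suc (suc K))) j

item-surjective : ∀ K (φ : Fm ℒ∈ (suc (suc K))) → depth φ ≤ K →
                  Σ ℕ λ N → (item N ≡ (K , φ)) × K ≤ N
item-surjective K φ h with nth-∈ {a = ⊥̇} (∈-formulas φ h)
... | j , e with unpair-surjective K j
...   | N , e′ = N , helper , subst (_≤ N) (cong proj₁ e′) (unpair-≤ N)
  where
  helper : item N ≡ (K , φ)
  helper rewrite e′ = cong (K ,_) e

transport₁ transport₀ : ∀ N → Item → Fm ℒ∈ (suc (suc N))
transport₁ N (K , φ) = ren (ext (var N ∘ level)) φ
transport₀ N (K , φ) = ren (var (suc N) ∘ level) φ

witness candidate : ∀ N → Fm ℒ∈ (suc (suc N))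
witness N   = transport₁ N (item N)
candidate N = transport₀ N (item N)

bound : ∀ {n} → (Fin n → ℕ) → ℕ
bound {zero}  ρ = 0
bound {suc n} ρ = ρ zero ⊔ bound (ρ ∘ suc)

≤-bound : ∀ {n} (ρ : Fin n → ℕ) i → ρ i ≤ bound ρ
≤-bound ρ zero    = m≤m⊔n _ _
≤-bound ρ (suc i) = ≤-trans (≤-bound (ρ ∘ suc) i) (m≤n⊔m (ρ zero) _)

witness-surjective : ∀ {n} (φ : Fm ℒ∈ (suc n)) (ρ : Fin n → ℕ) →
  Σ ℕ λ N → (∀ i → ρ i ≤ N) × (witness N ≡ ren (ext (var N ∘ ρ)) φ)
witness-surjective φ ρ with item-surjective K ψ (subst (_≤ K) (sym (depth-ren _ φ)) (m≤m⊔n (depth φ) _))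
  where
  -- `K` must bound the depth, for the formula to be listed, and the parameters, for `level-var` to
  -- recover them.
  K = depth φ ⊔ bound ρ
  ψ = ren (ext (var K ∘ ρ)) φ
... | N , e , h = N , (λ i → ≤-trans (ρ≤K i) h) , helper
  where
  K = depth φ ⊔ bound ρ
  ρ≤K : ∀ i → ρ i ≤ K
  ρ≤K i = ≤-trans (≤-bound ρ i) (m≤n⊔m (depth φ) _)
  helper : witness N ≡ ren (ext (var N ∘ ρ)) φ
  helper = trans (cong (transport₁ N) e) (ren-∘ (ext-∘ λ i → cong (var N) (level-var K (ρ≤K i))) φ)

candidate-surjective : ∀ {n} (φ : Fm ℒ∈ n) (ρ : Fin n → ℕ) →
  Σ ℕ λ N → (∀ i → ρ i ≤ suc N) × (candidate N ≡ ren (var (suc N) ∘ ρ) φ)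
candidate-surjective φ ρ with item-surjective K ψ (subst (_≤ K) (sym (depth-ren _ φ)) (m≤m⊔n (depth φ) _))
  where
  K = depth φ ⊔ bound ρ
  ψ = ren (var (suc K) ∘ ρ) φ
... | N , e , h = N , (λ i → ≤-trans (ρ≤K i) (s≤s h)) , helper
  where
  K = depth φ ⊔ bound ρ
  ρ≤K : ∀ i → ρ i ≤ suc K
  ρ≤K i = m≤n⇒m≤1+n (≤-trans (≤-bound ρ i) (m≤n⊔m (depth φ) _))
  helper : candidate N ≡ ren (var (suc N) ∘ ρ) φ
  helper = trans (cong (transport₀ N) e) (ren-∘ (λ i → cong (var (suc N)) (level-var (suc K) (ρ≤K i))) φ)

infixr 5 _∷ᵉ_
_∷ᵉ_ : ∀ {n} {A : Set} → A → (Fin n → A) → Fin (suc n) → A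
(d ∷ᵉ ρ) zero    = d
(d ∷ᵉ ρ) (suc i) = ρ i

[]ᵉ : ∀ {A : Set} → Fin 0 → A
[]ᵉ ()

-- Completeness

-- As in Krivine's constructive proof of the completeness theorem, a candidate enters the maximal
-- theory under a condition instead of after a decision about consistency.

module Lindenbaum (T : Theory ℒ∈) where

  -- Stage 0 has one parameter, so that a variable is in scope at every stage, as
  -- `henkin-conservative` requires; `nonempty` discharges it in `completeness`.
  lift₁ : Sentence ℒ∈ → Fm ℒ∈ 1
  lift₁ = ren (λ ())

  data Start : Fm ℒ∈ 1 → Set where
    axiom : ∀ {A} → T A → Start (lift₁ A)

  data Extend {N} (P : Fm ℒ∈ (suc N) → Set) (c : Fm ℒ∈ (suc N)) : Fm ℒ∈ (suc N) → Set where
    old : ∀ {ψ} → P ψ → Extend P c ψ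
    new : (P ⊕ c ⊢∞ ⊥̇ → P ⊢∞ ⊥̇) → Extend P c c

  Stage  : ∀ N → Fm ℒ∈ (suc N) → Set
  Stage⁺ : ∀ N → Fm ℒ∈ (suc (suc N)) → Set
  Stage zero    = Start
  Stage (suc N) = Extend (Stage⁺ N) (candidate N)
  Stage⁺ N = Wk (Stage N) ⊕ henkin (witness N)

  Inconsistent : Set
  Inconsistent = Stage 0 ⊢∞ ⊥̇

  -- If the derivation uses the candidate, any one of its entries carries the implication that
  -- removes it; otherwise the derivation is already one from `P`.
  extend-conservative : ∀ {N} {P : Fm ℒ∈ (suc N) → Set} {c} → Extend P c ⊢∞ ⊥̇ → P ⊢∞ ⊥̇
  extend-conservative {P = P} {c} (Γ , ps , d) with split ps
    where
    split : ∀ {Γ} → All (Extend P c) Γ → All P Γ ⊎ ((P ⊕ c ⊢∞ ⊥̇ → P ⊢∞ ⊥̇) × All (P ⊕ c) Γ)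
    split [] = inj₁ []
    split (old p ∷ ps) with split ps
    ... | inj₁ qs       = inj₁ (p ∷ qs)
    ... | inj₂ (h , qs) = inj₂ (h , old p ∷ qs)
    split (new h ∷ ps) with split ps
    ... | inj₁ qs       = inj₂ (h , new ∷ All.map old qs)
    ... | inj₂ (_ , qs) = inj₂ (h , new ∷ qs)
  ... | inj₁ qs       = Γ , qs , d
  ... | inj₂ (h , qs) = h (Γ , qs , d)

  stage-up : ∀ {N φ} → Stage N ⊢∞ φ → Stage (suc N) ⊢∞ wk φ
  stage-up p = ⊢∞-mono (λ q → old (old q)) (⊢∞-wk p)

  inconsistent : ∀ N → Stage N ⊢∞ ⊥̇ → Inconsistent
  inconsistent zero    p = p
  inconsistent (suc N) p = inconsistent N (henkin-conservative (extend-conservative p))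

  explode : Inconsistent → ∀ N {φ} → Stage N ⊢∞ φ
  explode p zero    = ⊢∞-cut (_ ∷ []) (p ∷ []) (⊥̇E (hyp (here refl)))
  explode p (suc N) = ⊢∞-cut (_ ∷ []) (stage-up (explode p N {⊥̇}) ∷ []) (⊥̇E (hyp (here refl)))

  record True {n} (φ : Fm ℒ∈ n) (ρ : Fin n → ℕ) : Set where
    constructor true
    field
      stage : ℕ
      below : ∀ i → ρ i ≤ stage
      proof : Stage stage ⊢∞ ren (var stage ∘ ρ) φ
  open True

  raise : ∀ {n} {φ : Fm ℒ∈ n} {ρ} → ∀ k (t : True φ ρ) → Stage (k + stage t) ⊢∞ ren (var (k + stage t) ∘ ρ) φ
  raise zero t = proof t
  raise {φ = φ} {ρ} (suc k) t =
    subst (Stage (suc (k + stage t)) ⊢∞_)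
      (ren-∘ (λ i → var-suc (≤-trans (below t i) (m≤n+m _ k))) φ)
      (stage-up (raise k t))

  raise≤ : ∀ {n} {φ : Fm ℒ∈ n} {ρ} (t : True φ ρ) {M} → stage t ≤ M → Stage M ⊢∞ ren (var M ∘ ρ) φ
  raise≤ {φ = φ} {ρ} t {M} h = subst (λ M → Stage M ⊢∞ ren (var M ∘ ρ) φ) (m∸n+n≡m h) (raise (M ∸ stage t) t)

  True-⊢ : ∀ {n ρ} (Γ : List (Fm ℒ∈ n)) → All (λ ψ → True ψ ρ) Γ → ∀ {φ} → Γ ⊢ φ → True φ ρ
  True-⊢ {ρ = ρ} Γ ts d = true M (λ i → ≤-trans (≤-bound ρ i) (m≤n⊔m (top ts) (bound ρ)))
      (⊢∞-cut (map (ren (var M ∘ ρ)) Γ) (AllP.map⁺ (go ts (m≤m⊔n (top ts) _)))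
        (⊢-ren (var M ∘ ρ) (∈-map⁺ (ren (var M ∘ ρ))) d))
    where
    top : ∀ {Γ} → All (λ ψ → True ψ ρ) Γ → ℕ
    top []       = 0
    top (t ∷ ts) = stage t ⊔ top ts
    M = top ts ⊔ bound ρ
    go : ∀ {Γ} (ts : All (λ ψ → True ψ ρ) Γ) → top ts ≤ M → All (λ ψ → Stage M ⊢∞ ren (var M ∘ ρ) ψ) Γ
    go []       h = []
    go (t ∷ ts) h = raise≤ t (≤-trans (m≤m⊔n _ _) h) ∷ go ts (≤-trans (m≤n⊔m (stage t) _) h)

  True-axiom : ∀ {A} → T A → True A []ᵉ
  True-axiom {A} t = true 0 (λ ()) (ax∞ (subst Start (ren-cong (λ ()) A) (axiom t)))

  True-⊥̇ : ∀ {n} {ρ : Fin n → ℕ} → True ⊥̇ ρ → Inconsistent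
  True-⊥̇ (true N _ p) = inconsistent N p

  -- Maximality without a decision: if `φ` were refuted at its stage, `¬̇ φ` would be true, the
  -- hypothesis would make the whole theory inconsistent, and then the stage proves falsity, as
  -- admission of `φ` demands.
  True-contra : ∀ {n} {φ : Fm ℒ∈ n} {ρ} → (True (¬̇ φ) ρ → Inconsistent) → True φ ρ
  True-contra {φ = φ} {ρ} h with candidate-surjective φ ρ
  ... | N , ρ≤ , e = true (suc N) ρ≤ (ax∞ (subst (Stage (suc N)) e (new admissible)))
    where
    admissible : Stage⁺ N ⊕ candidate N ⊢∞ ⊥̇ → Stage⁺ N ⊢∞ ⊥̇
    admissible p = ⊢∞-mono old
      (⊢∞-wk (explode (h (true (suc N) ρ≤
        (⊢∞-mono old (subst (λ χ → Stage⁺ N ⊢∞ ¬̇ χ) e (⊢∞-¬I p))))) N {⊥̇}))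


  True-henkin : ∀ {n} {φ : Fm ℒ∈ (suc n)} {ρ} → True (∃̇ φ) ρ → Σ ℕ λ d → True φ (d ∷ᵉ ρ)
  True-henkin {φ = φ} {ρ} t with witness-surjective φ ρ
  ... | N , ρ≤ , e = d , True-⊢ (ren suc (∃̇ φ) ∷ (ren suc (∃̇ φ) ⇒ φ) ∷ [])
           (true M below⁺ (subst (Stage M ⊢∞_) (sym (ren-∘ (λ _ → refl) (∃̇ φ))) (raise≤ t (m≤m⊔n _ _)))
           ∷ true (suc N) (λ { zero → ≤-refl ; (suc i) → m≤n⇒m≤1+n (ρ≤ i) }) axiomatic ∷ [])
           (⇒E (hyp (there (here refl))) (hyp (here refl)))
    where
    -- Stage 0 has the parameter 0, so the variable introduced on passing to stage `suc N` is
    -- counted as `suc N`; its Henkin axiom makes it the witness.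
    d = suc N
    M = stage t ⊔ suc N
    below⁺ : ∀ i → (d ∷ᵉ ρ) i ≤ M
    below⁺ zero    = m≤n⊔m (stage t) _
    below⁺ (suc i) = ≤-trans (below t i) (m≤m⊔n _ _)
    vars : ∀ i → ext (var N ∘ ρ) i ≡ var (suc N) ((d ∷ᵉ ρ) i)
    vars zero    = var-last N
    vars (suc i) = var-suc (ρ≤ i)
    axiomatic : Stage (suc N) ⊢∞ ren (var (suc N) ∘ (d ∷ᵉ ρ)) (henkin φ)
    axiomatic = subst (Stage (suc N) ⊢∞_)
      (trans (cong henkin e)
        (cong₂ _⇒_ (trans (ren-∘ (λ i → var-suc (ρ≤ i)) (∃̇ φ)) (sym (ren-∘ (λ _ → refl) (∃̇ φ))))
                   (ren-cong vars φ)))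
      (ax∞ (old new))

-- Logical equivalences and models

infix 1 _↔_
_↔_ : Set → Set → Set
X ↔ Y = (X → Y) × (Y → X)

↔-id : ∀ {X} → X ↔ X
↔-id = (λ x → x) , λ x → x

↔-trans : ∀ {X Y Z} → X ↔ Y → Y ↔ Z → X ↔ Z
↔-trans (f , f′) (g , g′) = (λ x → g (f x)) , λ z → f′ (g′ z)

infixr 4 _×↔_
infixr 3 _→↔_
_×↔_ : ∀ {X X′ Y Y′} → X ↔ X′ → Y ↔ Y′ → X × Y ↔ X′ × Y′
(f , f′) ×↔ (g , g′) = (λ (x , y) → f x , g y) , λ (x , y) → f′ x , g′ y

_→↔_ : ∀ {X X′ Y Y′} → X ↔ X′ → Y ↔ Y′ → (X → Y) ↔ (X′ → Y′)
(f , f′) →↔ (g , g′) = (λ h x → g (h (f′ x))) , λ h x → g′ (h (f x))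

Π↔ : ∀ {A : Set} {X Y : A → Set} → (∀ a → X a ↔ Y a) → (∀ a → X a) ↔ (∀ a → Y a)
Π↔ h = (λ f a → proj₁ (h a) (f a)) , λ f a → proj₂ (h a) (f a)

-- Falsity is an arbitrary proposition B, and classical existence and disjunction are encoded as
-- B-continuations; every formula then satisfies double negation elimination relative to B.
record Model : Set₁ where
  field
    D B    : Set
    Mem Eq : D → D → Set
    point  : D
  M : Set → Set
  M X = (X → B) → B
  field
    Mem-stable : ∀ {x y} → M (Mem x y) → Mem x y
    Eq-stable  : ∀ {x y} → M (Eq x y) → Eq x y
    Eq-refl    : ∀ {x} → Eq x x
    Eq-sym     : ∀ {x y} → Eq x y → Eq y x
    Eq-trans   : ∀ {x y z} → Eq x y → Eq y z → Eq x z
    Mem-cong   : ∀ {x x′ y y′} → Eq x x′ → Eq y y′ → Mem x y → Mem x′ y′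

  Rel : Set₁
  Rel = D → D → Set

  ⟦_⟧ : ∀ {L n} → Fm L n → Rel → (Fin n → D) → Set
  ⟦ x ∈̇ y ⟧ R ρ = Mem (ρ x) (ρ y)
  ⟦ x ≐ y ⟧ R ρ = Eq (ρ x) (ρ y)
  ⟦ Ṙ x y ⟧ R ρ = R (ρ x) (ρ y)
  ⟦ φ ∧̇ ψ ⟧ R ρ = ⟦ φ ⟧ R ρ × ⟦ ψ ⟧ R ρ
  ⟦ φ ∨̇ ψ ⟧ R ρ = M (⟦ φ ⟧ R ρ ⊎ ⟦ ψ ⟧ R ρ)
  ⟦ φ ⇒ ψ ⟧ R ρ = ⟦ φ ⟧ R ρ → ⟦ ψ ⟧ R ρ
  ⟦ ¬̇ φ   ⟧ R ρ = ⟦ φ ⟧ R ρ → B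
  ⟦ ∀̇ φ   ⟧ R ρ = ∀ d → ⟦ φ ⟧ R (d ∷ᵉ ρ)
  ⟦ ∃̇ φ   ⟧ R ρ = M (Σ D λ d → ⟦ φ ⟧ R (d ∷ᵉ ρ))

  infix 2 _⊨_
  _⊨_ : ∀ {n} → (Fin n → D) → Fm ℒ∈ n → Set
  ρ ⊨ φ = ⟦ φ ⟧ (λ _ _ → B) ρ

module TermModel (T : Theory ℒ∈) where
  open Lindenbaum T
  open True

  pattern h₀ = hyp (here refl)
  pattern h₁ = hyp (there (here refl))
  pattern h₂ = hyp (there (there (here refl)))

  True-ren : ∀ {m n} {φ : Fm ℒ∈ m} {σ : Fin m → Fin n} {ρ ρ′} →
             (∀ i → ρ (σ i) ≡ ρ′ i) → True (ren σ φ) ρ ↔ True φ ρ′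
  True-ren {φ = φ} {σ} {ρ} {ρ′} h = to , from
    where
    same : ∀ N → ren (var N ∘ ρ) (ren σ φ) ≡ ren (var N ∘ ρ′) φ
    same N = ren-∘ (λ i → cong (var N) (h i)) φ
    to : True (ren σ φ) ρ → True φ ρ′
    to (true N b p) = true N (λ i → subst (_≤ N) (h i) (b (σ i))) (subst (Stage N ⊢∞_) (same N) p)
    from : True φ ρ′ → True (ren σ φ) ρ
    from t = true N (λ i → ≤-trans (≤-bound ρ i) (m≤n⊔m (stage t) _))
      (subst (Stage N ⊢∞_) (sym (same N)) (raise≤ t (m≤m⊔n _ _)))
      where N = stage t ⊔ bound ρ

  True-stable : ∀ {n} {φ : Fm ℒ∈ n} {ρ} → ((True φ ρ → Inconsistent) → Inconsistent) → True φ ρ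
  True-stable h = True-contra λ t → h λ s → True-⊥̇ (True-⊢ (_ ∷ _ ∷ []) (s ∷ t ∷ []) (¬E h₀ h₁))

  Mem-true Eq-true : ℕ → ℕ → Set
  Mem-true x y = True (zero ∈̇ suc zero) (x ∷ᵉ y ∷ᵉ []ᵉ)
  Eq-true  x y = True (zero ≐ suc zero) (x ∷ᵉ y ∷ᵉ []ᵉ)

  ∈̇-true : ∀ {n} {ρ : Fin n → ℕ} i j → True (i ∈̇ j) ρ ↔ Mem-true (ρ i) (ρ j)
  ∈̇-true i j = True-ren {φ = zero ∈̇ suc zero} {σ = i ∷ᵉ j ∷ᵉ []ᵉ} λ { zero → refl ; (suc zero) → refl }

  ≐-true : ∀ {n} {ρ : Fin n → ℕ} i j → True (i ≐ j) ρ ↔ Eq-true (ρ i) (ρ j)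
  ≐-true i j = True-ren {φ = zero ≐ suc zero} {σ = i ∷ᵉ j ∷ᵉ []ᵉ} λ { zero → refl ; (suc zero) → refl }

  termModel : Model
  termModel = record
    { D = ℕ
    ; B = Inconsistent
    ; Mem = Mem-true
    ; Eq = Eq-true
    ; point = 0
    ; Mem-stable = True-stable
    ; Eq-stable = True-stable
    ; Eq-refl = λ {x} → proj₁ (≐-true {ρ = x ∷ᵉ []ᵉ} zero zero) (True-⊢ [] [] (≐refl zero))
    ; Eq-sym = λ {x} {y} p → proj₁ (≐-true {ρ = x ∷ᵉ y ∷ᵉ []ᵉ} (# 1) (# 0))
        (True-⊢ (_ ∷ []) (p ∷ []) (≐E {φ = # 0 ≐ # 1} h₀ (≐refl (# 0))))
    ; Eq-trans = λ {x} {y} {z} p q → let ρ = x ∷ᵉ y ∷ᵉ z ∷ᵉ []ᵉ in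
        proj₁ (≐-true {ρ = ρ} (# 0) (# 2))
          (True-⊢ (_ ∷ _ ∷ []) (proj₂ (≐-true {ρ = ρ} (# 0) (# 1)) p ∷ proj₂ (≐-true {ρ = ρ} (# 1) (# 2)) q ∷ [])
            (≐E {φ = # 1 ≐ # 0} h₁ h₀))
    ; Mem-cong = λ {x} {x′} {y} {y′} p q r → let ρ = x ∷ᵉ x′ ∷ᵉ y ∷ᵉ y′ ∷ᵉ []ᵉ in
        proj₁ (∈̇-true {ρ = ρ} (# 1) (# 3))
          (True-⊢ (_ ∷ _ ∷ _ ∷ [])
            (proj₂ (≐-true {ρ = ρ} (# 0) (# 1)) p ∷ proj₂ (≐-true {ρ = ρ} (# 2) (# 3)) q
              ∷ proj₂ (∈̇-true {ρ = ρ} (# 0) (# 2)) r ∷ [])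
            (≐E {φ = # 2 ∈̇ # 0} h₁ (≐E {φ = # 0 ∈̇ # 3} h₀ h₂)))
    }

  open Model termModel

  truth : ∀ {n} (φ : Fm ℒ∈ n) {ρ} → (ρ ⊨ φ) ↔ True φ ρ
  truth (x ∈̇ y) = proj₂ (∈̇-true x y) , proj₁ (∈̇-true x y)
  truth (x ≐ y) = proj₂ (≐-true x y) , proj₁ (≐-true x y)
  truth (φ ∧̇ ψ) =
    (λ (p , q) → True-⊢ (_ ∷ _ ∷ []) (proj₁ (truth φ) p ∷ proj₁ (truth ψ) q ∷ []) (∧I h₀ h₁)) ,
    (λ t → proj₂ (truth φ) (True-⊢ (_ ∷ []) (t ∷ []) (∧E₁ h₀)) , proj₂ (truth ψ) (True-⊢ (_ ∷ []) (t ∷ []) (∧E₂ h₀)))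
  truth (φ ∨̇ ψ) =
    (λ m → True-stable λ k → m λ
      { (inj₁ p) → k (True-⊢ (_ ∷ []) (proj₁ (truth φ) p ∷ []) (∨I₁ h₀))
      ; (inj₂ q) → k (True-⊢ (_ ∷ []) (proj₁ (truth ψ) q ∷ []) (∨I₂ h₀)) }) ,
    (λ t k → True-⊥̇ (True-⊢ (_ ∷ _ ∷ _ ∷ [])
      (t ∷ True-contra {φ = ¬̇ φ} (λ s → k (inj₁ (proj₂ (truth φ) (True-⊢ (_ ∷ []) (s ∷ []) (¬¬E h₀)))))
         ∷ True-contra {φ = ¬̇ ψ} (λ s → k (inj₂ (proj₂ (truth ψ) (True-⊢ (_ ∷ []) (s ∷ []) (¬¬E h₀))))) ∷ [])
      (∨E h₀ (¬E h₀ h₂) (¬E h₀ (hyp (there (there (there (here refl)))))))))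
  truth (φ ⇒ ψ) =
    (λ f → True-contra λ t → True-⊥̇ (True-⊢ (_ ∷ _ ∷ [])
      (proj₁ (truth ψ) (f (proj₂ (truth φ) (True-⊢ (_ ∷ []) (t ∷ [])
         (¬¬E (¬I (⇒I (¬E h₀ h₁)) h₁))))) ∷ t ∷ [])
      (¬E (⇒I h₁) h₁))) ,
    (λ t p → proj₂ (truth ψ) (True-⊢ (_ ∷ _ ∷ []) (t ∷ proj₁ (truth φ) p ∷ []) (⇒E h₀ h₁)))
  truth (¬̇ φ) =
    (λ f → True-contra λ t → f (proj₂ (truth φ) (True-⊢ (_ ∷ []) (t ∷ []) (¬¬E h₀)))) ,
    (λ t p → True-⊥̇ (True-⊢ (_ ∷ _ ∷ []) (t ∷ proj₁ (truth φ) p ∷ []) (¬E h₁ h₀)))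
  truth (∀̇ φ) =
    (λ f → True-contra λ t →
      let d , s = True-henkin (True-⊢ (_ ∷ []) (t ∷ [])
                    (¬¬E (¬I (∀I (¬¬E (¬I (∃I zero (⊢-≡ (sym (ext-suc-inst (¬̇ φ))) h₀)) h₁))) h₁)))
      in True-⊥̇ (True-⊢ (_ ∷ _ ∷ []) (s ∷ proj₁ (truth φ) (f d) ∷ []) (¬E h₁ h₀))) ,
    (λ t d → proj₂ (truth φ) (True-⊢ (_ ∷ []) (proj₂ (True-ren {φ = ∀̇ φ} {σ = suc} (λ _ → refl)) t ∷ [])
      (⊢-≡ (ext-suc-inst φ) (∀E h₀ zero))))
  truth (∃̇ φ) =
    (λ m → True-stable λ k → m λ (d , p) → k (proj₁ (True-ren {φ = ∃̇ φ} {σ = suc} (λ _ → refl))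
      (True-⊢ (_ ∷ []) (proj₁ (truth φ) p ∷ []) (∃I zero (⊢-≡ (sym (ext-suc-inst φ)) h₀))))) ,
    (λ t k → let d , s = True-henkin t in k (d , proj₂ (truth φ) s))

-- The term model of `T ⊕ ¬̇ A` satisfies `T`, hence `A`, while `¬̇ A` is true in it. Falsity of
-- that model is inconsistency of the theory, so this yields an actual derivation of falsity.
completeness : (T : Theory ℒ∈) (A : Sentence ℒ∈) →
  (∀ 𝔐 → (∀ {C} → T C → Model._⊨_ 𝔐 []ᵉ C) → Model._⊨_ 𝔐 []ᵉ A) → T ⊩ A
completeness T A valid = conclude (True-⊥̇ refuted)
  where
  T′ : Theory ℒ∈
  T′ = T ⊕ ¬̇ A
  open Lindenbaum T′
  open TermModel T′
  refuted : True {0} ⊥̇ []ᵉ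
  refuted = True-⊢ (_ ∷ _ ∷ []) (True-axiom new ∷ proj₁ (truth A) (valid termModel λ {C} t → proj₂ (truth C) (True-axiom (old t))) ∷ [])
    (¬E h₁ h₀)
  unlift : ∀ {Γ} → All Start Γ → Σ (List (Sentence ℒ∈)) λ Δ → All T′ Δ × (Γ ≡ map lift₁ Δ)
  unlift [] = [] , [] , refl
  unlift (axiom t ∷ ps) with unlift ps
  ... | Δ , ts , refl = _ ∷ Δ , t ∷ ts , refl
  conclude : Inconsistent → T ⊩ A
  conclude (Γ , ps , d) with unlift ps
  ... | Δ , ts , refl = ⊢∞-cut (¬̇ (¬̇ A) ∷ []) (⊢∞-¬I (Δ , ts , ∃E nonempty (⊢-weaken sub d)) ∷ []) (¬¬E h₀)
    where
    sub : ∀ {ψ} → ψ ∈ map lift₁ Δ → ψ ∈ (zero ≐ zero) ∷ map wk Δ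
    sub i with ∈-map⁻ lift₁ i
    ... | χ , j , refl = there (subst (_∈ map wk Δ) (ren-cong (λ ()) χ) (∈-map⁺ wk j))

-- Set theory in a model

nice : ∀ {L n} → Fin n → Fm L n
nice s = ∀∈ s (zero ⊆̇ suc s) ∧̇ ∀∈ s (∀⊆ zero (zero ∈̇ suc (suc s)))

-- A bounded form of `isDoub`, usable in Δ₀ᴾ formulas.
doub : ∀ {L n} → Fin n → Fin n → Fin n → Fm L n
doub v x y = x ∈̇ v ∧̇ y ∈̇ v ∧̇ ∀∈ v (zero ≐ suc x ∨̇ zero ≐ suc y)

⊆-Δ : ∀ {L n} (x y : Fin n) → Δ₀ᴾ {L} (x ⊆̇ y)
⊆-Δ x y = ∀∈-c x (∈-at _ _)

nice-Δ : ∀ {L n} (s : Fin n) → Δ₀ᴾ {L} (nice s)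
nice-Δ s = ∧-c (∀∈-c s (⊆-Δ _ _)) (∀∈-c s (∀⊆-c zero (∈-at _ _)))

doub-Δ : ∀ {L n} (v x y : Fin n) → Δ₀ᴾ {L} (doub v x y)
doub-Δ v x y = ∧-c (∈-at _ _) (∧-c (∈-at _ _) (∀∈-c v (∨-c (≐-at _ _) (≐-at _ _))))

Δ-ren : ∀ {L m n} {σ : Fin m → Fin n} {φ : Fm L m} → Δ₀ᴾ φ → Δ₀ᴾ (ren σ φ)
Δ-ren (∈-at x y) = ∈-at _ _
Δ-ren (≐-at x y) = ≐-at _ _
Δ-ren (R-at x y) = R-at _ _
Δ-ren (∧-c d e)  = ∧-c (Δ-ren d) (Δ-ren e)
Δ-ren (∨-c d e)  = ∨-c (Δ-ren d) (Δ-ren e)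
Δ-ren (⇒-c d e)  = ⇒-c (Δ-ren d) (Δ-ren e)
Δ-ren (¬-c d)    = ¬-c (Δ-ren d)
Δ-ren (∀∈-c a d) = ∀∈-c _ (Δ-ren d)
Δ-ren (∃∈-c a d) = ∃∈-c _ (Δ-ren d)
Δ-ren (∀⊆-c a d) = ∀⊆-c _ (Δ-ren d)
Δ-ren (∃⊆-c a d) = ∃⊆-c _ (Δ-ren d)

module Semantics (𝔐 : Model) where
  open Model 𝔐 public

  infix 4 _ε_ _⊆_
  _ε_ : D → D → Set
  _ε_ = Mem

  _⊆_ : D → D → Set
  x ⊆ y = ∀ z → z ε x → z ε y

  Congruent : Rel → Set
  Congruent R = ∀ {x x′ y y′} → Eq x x′ → Eq y y′ → R x y → R x′ y′

  infixr 5 _∷ˢ_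
  _∷ˢ_ : ∀ {n s d} {ρ : Fin n → D} → d ε s → (∀ i → ρ i ε s) → ∀ i → (d ∷ᵉ ρ) i ε s
  (p ∷ˢ h) zero    = p
  (p ∷ˢ h) (suc i) = h i

  M⊎↔ : ∀ {X X′ Y Y′} → X ↔ X′ → Y ↔ Y′ → M (X ⊎ Y) ↔ M (X′ ⊎ Y′)
  M⊎↔ (f , f′) (g , g′) =
    (λ m k → m λ { (inj₁ x) → k (inj₁ (f x)) ; (inj₂ y) → k (inj₂ (g y)) }) ,
    (λ m k → m λ { (inj₁ x) → k (inj₁ (f′ x)) ; (inj₂ y) → k (inj₂ (g′ y)) })

  MΣ↔ : ∀ {A : Set} {X Y : A → Set} → (∀ a → X a ↔ Y a) → M (Σ A X) ↔ M (Σ A Y)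
  MΣ↔ h = (λ m k → m λ (a , x) → k (a , proj₁ (h a) x)) , λ m k → m λ (a , y) → k (a , proj₂ (h a) y)

  Mem-≈ : ∀ {x x′ y y′} → Eq x x′ → Eq y y′ → x ε y ↔ x′ ε y′
  Mem-≈ p q = Mem-cong p q , Mem-cong (Eq-sym p) (Eq-sym q)

  Eq-≈ : ∀ {x x′ y y′} → Eq x x′ → Eq y y′ → Eq x y ↔ Eq x′ y′
  Eq-≈ p q = (λ e → Eq-trans (Eq-sym p) (Eq-trans e q)) , λ e → Eq-trans p (Eq-trans e (Eq-sym q))

  ∷ᵉ-≈ : ∀ {m n} {σ : Fin m → Fin n} {ρ ρ′} → (∀ i → Eq (ρ (σ i)) (ρ′ i)) →
         ∀ d i → Eq ((d ∷ᵉ ρ) (ext σ i)) ((d ∷ᵉ ρ′) i)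
  ∷ᵉ-≈ h d zero    = Eq-refl
  ∷ᵉ-≈ h d (suc i) = h i

  -- The environments are compared up to `Eq`, so that one induction yields both the substitution
  -- lemma and invariance under equality.
  ⟦ren⟧ : ∀ {L m n} (φ : Fm L m) {R} → Congruent R → {σ : Fin m → Fin n} {ρ : Fin n → D} {ρ′ : Fin m → D} →
          (∀ i → Eq (ρ (σ i)) (ρ′ i)) → ⟦ ren σ φ ⟧ R ρ ↔ ⟦ φ ⟧ R ρ′
  ⟦ren⟧ (x ∈̇ y) c h = Mem-≈ (h x) (h y)
  ⟦ren⟧ (x ≐ y) c h = Eq-≈ (h x) (h y)
  ⟦ren⟧ (Ṙ x y) c h = c (h x) (h y) , c (Eq-sym (h x)) (Eq-sym (h y))
  ⟦ren⟧ (φ ∧̇ ψ) c h = ⟦ren⟧ φ c h ×↔ ⟦ren⟧ ψ c h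
  ⟦ren⟧ (φ ∨̇ ψ) c h = M⊎↔ (⟦ren⟧ φ c h) (⟦ren⟧ ψ c h)
  ⟦ren⟧ (φ ⇒ ψ) c h = ⟦ren⟧ φ c h →↔ ⟦ren⟧ ψ c h
  ⟦ren⟧ (¬̇ φ)   c h = ⟦ren⟧ φ c h →↔ ↔-id
  ⟦ren⟧ (∀̇ φ)   c h = Π↔ λ d → ⟦ren⟧ φ c (∷ᵉ-≈ h d)
  ⟦ren⟧ (∃̇ φ)   c h = MΣ↔ λ d → ⟦ren⟧ φ c (∷ᵉ-≈ h d)

  ⟦⟧-cong : ∀ {L n} (φ : Fm L n) {R} → Congruent R → {ρ ρ′ : Fin n → D} →
            (∀ i → Eq (ρ i) (ρ′ i)) → ⟦ φ ⟧ R ρ → ⟦ φ ⟧ R ρ′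
  ⟦⟧-cong φ c h p = proj₁ (⟦ren⟧ φ c {σ = id} h) (proj₂ (⟦ren⟧ φ c {σ = id} λ _ → Eq-refl) p)

  ⊨-ren : ∀ {m n} (φ : Fm ℒ∈ m) {σ : Fin m → Fin n} {ρ : Fin n → D} {ρ′ : Fin m → D} →
          (∀ i → Eq (ρ (σ i)) (ρ′ i)) → (ρ ⊨ ren σ φ) ↔ (ρ′ ⊨ φ)
  ⊨-ren φ = ⟦ren⟧ φ (λ _ _ b → b)

  ⊨-cong : ∀ {n} (φ : Fm ℒ∈ n) {ρ ρ′ : Fin n → D} → (∀ i → Eq (ρ i) (ρ′ i)) → ρ ⊨ φ → ρ′ ⊨ φ
  ⊨-cong φ = ⟦⟧-cong φ (λ _ _ b → b)

  ⊨-close : ∀ n (φ : Fm ℒ∈ n) → []ᵉ ⊨ close n φ → ∀ ρ → ρ ⊨ φ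
  ⊨-close zero    φ p ρ = ⊨-cong φ (λ ()) p
  ⊨-close (suc n) φ p ρ = ⊨-cong φ (λ { zero → Eq-refl ; (suc i) → Eq-refl })
                            (⊨-close n (∀̇ φ) p (ρ ∘ suc) (ρ zero))

  Nice : D → Set
  Nice s = (∀ x → x ε s → x ⊆ s) × (∀ x → x ε s → ∀ y → y ⊆ x → y ε s)

  Doub : D → D → D → Set
  Doub v x y = x ε v × y ε v × (∀ z → z ε v → M (Eq z x ⊎ Eq z y))

module KPTheory (𝔐 : Model) (holds : ∀ {C} → KPᴾ+AC C → Model._⊨_ 𝔐 []ᵉ C) where
  open Semantics 𝔐 public

  extensional : ∀ {a b} → a ⊆ b → b ⊆ a → Eq a b
  extensional {a} {b} h h′ = Eq-sym (holds (kp extensionality) b a λ z → h′ z , h z)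

  separation : ∀ {n} {φ : Fm ℒ∈ (suc (suc n))} → Δ₀ᴾ φ → ∀ a (ρ : Fin n → D) →
               M (Σ D λ x → ∀ u → u ε x ↔ u ε a × (u ∷ᵉ a ∷ᵉ ρ ⊨ φ))
  separation {n} {φ} δ a ρ k = ⊨-close (suc n) _ (holds (kp (sep n φ δ))) (a ∷ᵉ ρ) λ (x , h) → k (x , λ u →
    (λ p → proj₁ (proj₁ (h u) p) , proj₁ (⊨-ren φ (same u x)) (proj₂ (proj₁ (h u) p))) ,
    (λ (p , q) → proj₂ (h u) (p , proj₂ (⊨-ren φ (same u x)) q)))
    where
    same : ∀ u x i → Eq ((u ∷ᵉ x ∷ᵉ a ∷ᵉ ρ) (ext suc i)) ((u ∷ᵉ a ∷ᵉ ρ) i)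
    same u x zero    = Eq-refl
    same u x (suc i) = Eq-refl

  collection : ∀ {n} {G : Fm ℒ∈ (suc (suc (suc n)))} → Δ₀ᴾ G → ∀ a (ρ : Fin n → D) →
               (∀ x → x ε a → M (Σ D λ y → y ∷ᵉ x ∷ᵉ a ∷ᵉ ρ ⊨ G)) →
               M (Σ D λ z → ∀ x → x ε a → M (Σ D λ y → y ε z × (y ∷ᵉ x ∷ᵉ a ∷ᵉ ρ ⊨ G)))
  collection {n} {G} δ a ρ h k = ⊨-close (suc n) _ (holds (kp (coll n G δ))) (a ∷ᵉ ρ) h λ (z , h′) →
    k (z , λ x p k′ → h′ x p λ (y , q , r) → k′ (y , q , proj₁ (⊨-ren G (same y x z)) r))
    where
    same : ∀ y x z i → Eq ((y ∷ᵉ x ∷ᵉ z ∷ᵉ a ∷ᵉ ρ) (ext (ext suc) i)) ((y ∷ᵉ x ∷ᵉ a ∷ᵉ ρ) i)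
    same y x z zero          = Eq-refl
    same y x z (suc zero)    = Eq-refl
    same y x z (suc (suc i)) = Eq-refl

  induction : ∀ {n} (φ : Fm ℒ∈ (suc n)) (ρ : Fin n → D) →
              (∀ a → (∀ x → x ε a → x ∷ᵉ ρ ⊨ φ) → a ∷ᵉ ρ ⊨ φ) → ∀ a → a ∷ᵉ ρ ⊨ φ
  induction {n} φ ρ h = ⊨-close n _ (holds (kp (ind n φ))) ρ λ a ih → h a λ x p →
    proj₁ (⊨-ren φ λ { zero → Eq-refl ; (suc i) → Eq-refl }) (ih x p)

  pairing : ∀ x y → M (Σ D λ v → Doub v x y)
  pairing x y k = holds (kp pair) x y λ (z , p , q) →
    separation {φ = # 0 ≐ # 2 ∨̇ # 0 ≐ # 3} (∨-c (≐-at _ _) (≐-at _ _)) z (x ∷ᵉ y ∷ᵉ []ᵉ) λ (v , h) →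
    k (v , proj₂ (h x) (p , λ k → k (inj₁ Eq-refl)) , proj₂ (h y) (q , λ k → k (inj₂ Eq-refl)) , λ u r → proj₂ (proj₁ (h u) r))

  power : ∀ x → M (Σ D λ p → ∀ u → u ε p ↔ u ⊆ x)
  power x k = holds (kp pow) x λ (z , h) →
    separation {φ = # 0 ⊆̇ # 2} (⊆-Δ _ _) z (x ∷ᵉ []ᵉ) λ (p , h′) →
    k (p , λ u → (λ q → proj₂ (proj₁ (h′ u) q)) , (λ q → proj₂ (h′ u) (h u q , q)))

  -- By set induction the members of `a` have nice sets around them. Their union `S` is transitive
  -- and includes `a`, and the power set of a transitive set is nice.
  nice-∋ : ∀ x → M (Σ D λ s → Nice s × x ε s)
  nice-∋ = induction (∃̇ (nice zero ∧̇ # 1 ∈̇ # 0)) []ᵉ λ a ih k →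
    collection {G = nice zero ∧̇ # 1 ∈̇ # 0} (∧-c (nice-Δ _) (∈-at _ _)) a []ᵉ ih λ (Z , hZ) →
    holds (kp union) Z λ (U , hU) →
    -- Collection may have put sets into `Z` that are not nice; only its nice members contribute to
    -- `S`.
    separation {φ = ∃∈ (# 2) (nice zero ∧̇ # 1 ∈̇ # 0)} (∃∈-c _ (∧-c (nice-Δ _) (∈-at _ _))) U (Z ∷ᵉ []ᵉ) λ (S , hS) →
    power S λ (P , hP) →
    let
      into : ∀ {s u} → s ε Z → Nice s → u ε s → u ε S
      into p n q = proj₂ (hS _) (hU _ p _ q , λ k → k (_ , p , n , q))
      transS : ∀ x → x ε S → x ⊆ S
      transS x p y q = Mem-stable λ k → proj₂ (proj₁ (hS x) p) λ (s , r , n , t) → k (into r n (proj₁ n x t y q))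
    in
    k (P , ((λ x p y q → proj₂ (hP y) (transS y (proj₁ (hP x) p y q)))
           , λ x p y q → proj₂ (hP y) λ z r → proj₁ (hP x) p z (q z r))
         , proj₂ (hP a) λ y p → Mem-stable λ k′ → hZ y p λ (s , q , n , r) → k′ (into q n r))

-- Pairs and choice relations coded by sets

-- The Kuratowski pair of `x` and `y`, with all quantifiers bounded in terms of `p`, unlike in
-- `isOPair`.
kur : ∀ {L n} → Fin n → Fin n → Fin n → Fm L n
kur p x y = ∃∈ p (∃∈ (suc p)
  (doub (# 1) (suc (suc x)) (suc (suc x)) ∧̇ doub (# 0) (suc (suc x)) (suc (suc y)) ∧̇ doub (suc (suc p)) (# 1) (# 0)))

-- The doubleton of two elements of s is a subset of s, hence an element of every nice set that
-- contains s. Kuratowski pairs would lie higher.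
chooses : ∀ {L n} → Fin n → Fin n → Fin n → Fm L n
chooses r x y = y ∈̇ x ∧̇ ∃∈ r (doub zero (suc x) (suc y))

-- A code may contain elements irrelevant to s, so relations on s are compared by what they choose
-- and not as sets.
agree : ∀ {L n} → Fin n → Fin n → Fin n → Fm L n
agree s r r′ = ∀∈ s (∀∈ (suc s) (chooses (suc (suc r)) (# 1) (# 0) ⇔ chooses (suc (suc r′)) (# 1) (# 0)))

functional total : ∀ {L n} → Fin n → Fin n → Fm L n
functional s r = ∀∈ s (∀∈ (suc s) (∀∈ (suc (suc s))
  (chooses (suc (suc (suc r))) (# 2) (# 1) ⇒ chooses (suc (suc (suc r))) (# 2) (# 0) ⇒ # 1 ≐ # 0)))
total s r = ∀∈ s (∀∈ zero (∃∈ (# 1) (chooses (suc (suc (suc r))) (# 2) (# 0))))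

kur-Δ : ∀ {L n} (p x y : Fin n) → Δ₀ᴾ {L} (kur p x y)
kur-Δ p x y = ∃∈-c p (∃∈-c _ (∧-c (doub-Δ _ _ _) (∧-c (doub-Δ _ _ _) (doub-Δ _ _ _))))

chooses-Δ : ∀ {L n} (r x y : Fin n) → Δ₀ᴾ {L} (chooses r x y)
chooses-Δ r x y = ∧-c (∈-at _ _) (∃∈-c r (doub-Δ _ _ _))

agree-Δ : ∀ {L n} (s r r′ : Fin n) → Δ₀ᴾ {L} (agree s r r′)
agree-Δ s r r′ = ∀∈-c s (∀∈-c _ (∧-c (⇒-c (chooses-Δ _ _ _) (chooses-Δ _ _ _)) (⇒-c (chooses-Δ _ _ _) (chooses-Δ _ _ _))))

functional-Δ : ∀ {L n} (s r : Fin n) → Δ₀ᴾ {L} (functional s r)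
functional-Δ s r = ∀∈-c s (∀∈-c _ (∀∈-c _ (⇒-c (chooses-Δ _ _ _) (⇒-c (chooses-Δ _ _ _) (≐-at _ _)))))

total-Δ : ∀ {L n} (s r : Fin n) → Δ₀ᴾ {L} (total s r)
total-Δ s r = ∀∈-c s (∀∈-c _ (∃∈-c _ (chooses-Δ _ _ _)))

module Pairs (𝔐 : Model) where
  open Semantics 𝔐

  Kur : D → D → D → Set
  Kur p x y = M (Σ D λ u → u ε p × M (Σ D λ v → v ε p × Doub u x x × Doub v x y × Doub p u v))

  -- The unordered pair {x, y} may stand for (x, y): by foundation, y ∈ x tells the components apart.
  Choice : D → Rel
  Choice r x y = y ε x × M (Σ D λ v → v ε r × Doub v x y)

  Agree : D → D → D → Set
  Agree s r r′ = ∀ x → x ε s → ∀ y → y ε s → Choice r x y ↔ Choice r′ x y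

  Functional Total : D → D → Set
  Functional s r = ∀ x → x ε s → ∀ y → y ε s → ∀ z → z ε s → Choice r x y → Choice r x z → Eq y z
  Total s r = ∀ x → x ε s → ∀ u → u ε x → M (Σ D λ y → y ε x × Choice r x y)

  Choice-cong : ∀ {r} → Congruent (Choice r)
  Choice-cong {r} {x} {x′} {y} {y′} p q = ⊨-cong (chooses (# 0) (# 1) (# 2))
    {r ∷ᵉ x ∷ᵉ y ∷ᵉ []ᵉ} {r ∷ᵉ x′ ∷ᵉ y′ ∷ᵉ []ᵉ} λ { zero → Eq-refl ; (suc zero) → p ; (suc (suc zero)) → q }

  Choice-≈ : ∀ {r x x′ y y′} → Eq x x′ → Eq y y′ → Choice r x y ↔ Choice r x′ y′
  Choice-≈ p q = Choice-cong p q , Choice-cong (Eq-sym p) (Eq-sym q)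

  Choice-stable : ∀ {r x y} → M (Choice r x y) → Choice r x y
  Choice-stable m = Mem-stable (λ k → m λ c → k (proj₁ c)) , λ k → m λ c → proj₂ c k

  Kur-cong : ∀ {p x x′ y y′} → Eq x x′ → Eq y y′ → Kur p x y → Kur p x′ y′
  Kur-cong {p} {x} {x′} {y} {y′} e f = ⊨-cong (kur (# 0) (# 1) (# 2))
    {p ∷ᵉ x ∷ᵉ y ∷ᵉ []ᵉ} {p ∷ᵉ x′ ∷ᵉ y′ ∷ᵉ []ᵉ} λ { zero → Eq-refl ; (suc zero) → e ; (suc (suc zero)) → f }

  Doub-cong : ∀ {v v′ x y} → Eq v v′ → Doub v x y → Doub v′ x y
  Doub-cong e (p , q , h) = Mem-cong Eq-refl e p , Mem-cong Eq-refl e q , λ z r → h z (Mem-cong Eq-refl (Eq-sym e) r)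

  Doub-⊆ : ∀ {v x y s} → x ε s → y ε s → Doub v x y → v ⊆ s
  Doub-⊆ p q d z r = Mem-stable λ k → proj₂ (proj₂ d) z r λ
    { (inj₁ e) → k (Mem-cong (Eq-sym e) Eq-refl p) ; (inj₂ e) → k (Mem-cong (Eq-sym e) Eq-refl q) }

  ∈-Doub₁ : ∀ {v x z} → Doub v x x → z ε v → Eq z x
  ∈-Doub₁ d p = Eq-stable λ k → proj₂ (proj₂ d) _ p λ { (inj₁ e) → k e ; (inj₂ e) → k e }

  Kur-injective : ∀ {p x y x′ y′} → Kur p x y → Kur p x′ y′ → M (Eq x x′ × Eq y y′)
  Kur-injective {x = x} {y} {x′} {y′} m m′ k =
    m λ (u , u∈p , m) → m λ (v , v∈p , du , dv , dp) →
    m′ λ (u′ , u′∈p , m′) → m′ λ (v′ , v′∈p , du′ , dv′ , dp′) →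
    let
      ∈-resp : ∀ {a b z} → Eq a b → z ε a → z ε b
      ∈-resp e = Mem-cong Eq-refl e
      x≈x′ : Eq x x′
      x≈x′ = Eq-stable λ k → proj₂ (proj₂ dp′) u u∈p λ
        { (inj₁ e) → k (∈-Doub₁ du′ (∈-resp e (proj₁ du)))
        ; (inj₂ e) → k (Eq-sym (∈-Doub₁ du (∈-resp (Eq-sym e) (proj₁ dv′)))) }
    in
    proj₂ (proj₂ dp′) v v∈p λ
      { (inj₁ v≈u′) → let y≈x′ = ∈-Doub₁ du′ (∈-resp v≈u′ (proj₁ (proj₂ dv))) in
          proj₂ (proj₂ dp) v′ v′∈p λ
            { (inj₁ v′≈u) → k (x≈x′ , Eq-trans y≈x′ (Eq-trans (Eq-sym x≈x′) (Eq-sym (∈-Doub₁ du (∈-resp v′≈u (proj₁ (proj₂ dv′)))))))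
            ; (inj₂ v′≈v) → k (x≈x′ , Eq-trans y≈x′ (Eq-sym (∈-Doub₁ du′ (∈-resp (Eq-trans v′≈v v≈u′) (proj₁ (proj₂ dv′)))))) }
      ; (inj₂ v≈v′) → proj₂ (proj₂ dv′) y (∈-resp v≈v′ (proj₁ (proj₂ dv))) λ
            { (inj₁ y≈x′) → proj₂ (proj₂ dv) y′ (∈-resp (Eq-sym v≈v′) (proj₁ (proj₂ dv′))) λ
                { (inj₁ y′≈x) → k (x≈x′ , Eq-trans y≈x′ (Eq-trans (Eq-sym x≈x′) (Eq-sym y′≈x)))
                ; (inj₂ y′≈y) → k (x≈x′ , Eq-sym y′≈y) }
            ; (inj₂ y≈y′) → k (x≈x′ , y≈y′) } }

  Agree-sym : ∀ {s r r′} → Agree s r r′ → Agree s r′ r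
  Agree-sym a x p y q = proj₂ (a x p y q) , proj₁ (a x p y q)

  Agree-trans : ∀ {s r r′ r″} → Agree s r r′ → Agree s r′ r″ → Agree s r r″
  Agree-trans a b x p y q = proj₁ (b x p y q) ∘ proj₁ (a x p y q) , proj₂ (a x p y q) ∘ proj₂ (b x p y q)

  Agree-⊆ : ∀ {s s′ r r′} → s′ ⊆ s → Agree s r r′ → Agree s′ r r′
  Agree-⊆ h a x p y q = a x (h x p) y (h y q)

module Choices (𝔐 : Model) (holds : ∀ {C} → KPᴾ+AC C → Model._⊨_ 𝔐 []ᵉ C) where
  open KPTheory 𝔐 holds public
  open Pairs 𝔐 public

  ∈-asym : ∀ a b → b ε a → a ε b → B
  ∈-asym = induction (∀∈ zero (¬̇ (# 1 ∈̇ # 0))) []ᵉ λ a ih b p q → ih b p a q p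

  kur-∃ : ∀ x y → M (Σ D λ p → Kur p x y)
  kur-∃ x y k = pairing x x λ (u , du) → pairing x y λ (v , dv) → pairing u v λ (p , dp) →
    k (p , λ k → k (u , proj₁ dp , λ k → k (v , proj₁ (proj₂ dp) , du , dv , dp)))

  Doub-unique : ∀ {v v′ x y} → Doub v x y → Doub v′ x y → Eq v v′
  Doub-unique d@(p , q , _) d′@(p′ , q′ , _) = extensional (Doub-⊆ p′ q′ d) (Doub-⊆ p q d′)

  -- A crossed match would give `y ε x` and `x ε y`, and any other unwanted match `x ε x`;
  -- foundation excludes both.
  Doub-injective : ∀ {v x y x′ y′} → y ε x → y′ ε x′ → Doub v x y → Doub v x′ y′ → M (Eq x x′ × Eq y y′)
  Doub-injective {x = x} {y} {x′} {y′} y∈x y′∈x′ (p , q , _) (_ , _ , h) k = h x p λ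
    { (inj₁ x≈x′) → h y q λ
        { (inj₁ y≈x′) → loop (Eq-trans y≈x′ (Eq-sym x≈x′))
        ; (inj₂ y≈y′) → k (x≈x′ , y≈y′) }
    ; (inj₂ x≈y′) → h y q λ
        { (inj₁ y≈x′) → ∈-asym x y y∈x (Mem-cong (Eq-sym x≈y′) (Eq-sym y≈x′) y′∈x′)
        ; (inj₂ y≈y′) → loop (Eq-trans y≈y′ (Eq-sym x≈y′)) } }
    where
    loop : Eq y x → B
    loop e = ∈-asym x x (Mem-cong e Eq-refl y∈x) (Mem-cong e Eq-refl y∈x)

  PairIn : D → D → D → Set
  PairIn x y f = x ∷ᵉ y ∷ᵉ f ∷ᵉ []ᵉ ⊨ pairIn (# 0) (# 1) (# 2)

  KurIn : D → D → D → Set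
  KurIn x y f = M (Σ D λ p → p ε f × Kur p x y)

  -- Translates the pairs of `acAx`, defined with unbounded quantifiers, into a form to which
  -- separation applies.
  PairIn⇔KurIn : ∀ {x y f} → PairIn x y f ↔ KurIn x y f
  PairIn⇔KurIn {x} {y} {f} = to , from
    where
    Sing : D → D → Set
    IsDoub : D → D → D → Set
    Sing q x = ∀ w → (w ε q → Eq w x) × (Eq w x → w ε q)
    IsDoub q x y = ∀ w → (w ε q → M (Eq w x ⊎ Eq w y)) × (M (Eq w x ⊎ Eq w y) → w ε q)
    sing→ : ∀ {q} → Sing q x → Doub q x x
    sing→ h = proj₂ (h x) Eq-refl , proj₂ (h x) Eq-refl , λ z p k → k (inj₁ (proj₁ (h z) p))
    →sing : ∀ {q} → Doub q x x → Sing q x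
    →sing d w = ∈-Doub₁ d , λ e → Mem-cong (Eq-sym e) Eq-refl (proj₁ d)
    doub→ : ∀ {q} → IsDoub q x y → Doub q x y
    doub→ h = proj₂ (h x) (λ k → k (inj₁ Eq-refl)) , proj₂ (h y) (λ k → k (inj₂ Eq-refl)) , λ z → proj₁ (h z)
    →doub : ∀ {q} → Doub q x y → IsDoub q x y
    →doub (p , q , h) w = h w , λ m → Mem-stable λ k → m λ
      { (inj₁ e) → k (Mem-cong (Eq-sym e) Eq-refl p) ; (inj₂ e) → k (Mem-cong (Eq-sym e) Eq-refl q) }
    to : PairIn x y f → KurIn x y f
    to m k = m λ (p , p∈f , h) → pairing x x λ (u , du) → pairing x y λ (v , dv) →
      let
        u∈p = proj₂ (h u) λ k → k (inj₁ (→sing du))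
        v∈p = proj₂ (h v) λ k → k (inj₂ (→doub dv))
      in
      k (p , p∈f , λ k → k (u , u∈p , λ k → k (v , v∈p , du , dv , u∈p , v∈p , λ z z∈p k → proj₁ (h z) z∈p λ
        { (inj₁ i) → k (inj₁ (Doub-unique (sing→ i) du)) ; (inj₂ i) → k (inj₂ (Doub-unique (doub→ i) dv)) })))
    from : KurIn x y f → PairIn x y f
    from m k = m λ (p , p∈f , m) → m λ (u , u∈p , m) → m λ (v , v∈p , du , dv , dp) →
      k (p , p∈f , λ q →
        (λ q∈p k → proj₂ (proj₂ dp) q q∈p λ
          { (inj₁ e) → k (inj₁ (→sing (Doub-cong (Eq-sym e) du))) ; (inj₂ e) → k (inj₂ (→doub (Doub-cong (Eq-sym e) dv))) }) ,
        λ m → Mem-stable λ k → m λ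
          { (inj₁ i) → k (Mem-cong (Doub-unique du (sing→ i)) Eq-refl u∈p)
          ; (inj₂ i) → k (Mem-cong (Doub-unique dv (doub→ i)) Eq-refl v∈p) })

  -- The only appeal to the axiom of choice. It is applied to the nonempty members of `s`, and the
  -- resulting function is recoded by doubletons, all of which lie in `U`.
  choice-∃ : ∀ {s U} → Nice s → Nice U → s ε U → M (Σ D λ r → r ⊆ U × Functional s r × Total s r)
  choice-∃ {s} {U} ns nU s∈U k =
    separation {φ = ∃∈ (# 0) (# 0 ≐ # 0)} (∃∈-c _ (≐-at _ _)) s []ᵉ λ (s⁺ , hs) →
    holds ac s⁺ (λ x p k → proj₂ (proj₁ (hs x) p) λ (u , q , _) → k (u , q)) λ (f , hf) →
    separation {φ = ∃∈ (# 2) (∃∈ (# 0) (doub (# 2) (# 1) (# 0) ∧̇ ∃∈ (# 5) (kur (# 0) (# 2) (# 1))))}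
      (∃∈-c _ (∃∈-c _ (∧-c (doub-Δ _ _ _) (∃∈-c _ (kur-Δ _ _ _))))) U (s ∷ᵉ f ∷ᵉ []ᵉ) λ (r , hr) →
    let
      nonempty : ∀ {x y} → x ε s → y ε x → x ε s⁺
      nonempty p q = proj₂ (hs _) (p , λ k → k (_ , q , Eq-refl))
      kurIn : ∀ {x y} → Choice r x y → KurIn x y f
      kurIn (q , m) k = m λ (v , v∈r , d) → proj₂ (proj₁ (hr v) v∈r) λ (x′ , p′ , m) → m λ (y′ , q′ , d′ , m) →
        Doub-injective q q′ d d′ λ (e , e′) → m λ (p , p∈f , κ) → k (p , p∈f , Kur-cong (Eq-sym e) (Eq-sym e′) κ)
    in
    k (r , (λ v p → proj₁ (proj₁ (hr v) p))
         , (λ x p y _ z _ c c′ → Eq-stable λ k → hf x (nonempty p (proj₁ c)) λ (w , _ , _ , unique) →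
             k (Eq-trans (unique y (proj₂ PairIn⇔KurIn (kurIn c))) (Eq-sym (unique z (proj₂ PairIn⇔KurIn (kurIn c′))))))
         , λ x p u q k → hf x (nonempty p q) λ (y , y∈x , i , _) → pairing x y λ (v , d) →
             k (y , y∈x , y∈x , λ k → k (v ,
               proj₂ (hr v) (proj₂ nU s s∈U v (Doub-⊆ p (proj₁ ns x p y y∈x) d)
                            , λ k → k (x , p , λ k → k (y , y∈x , d , proj₁ PairIn⇔KurIn i))) , d)))

  -- Intersecting with `U` keeps every doubleton from `s`, since it is a subset of `s` and thus an
  -- element of `U`.
  restrict : ∀ {s U} → Nice U → s ε U → ∀ r → M (Σ D λ r′ → r′ ⊆ U × Agree s r r′)
  restrict {s} {U} nU s∈U r k = separation {φ = # 0 ∈̇ # 2} (∈-at _ _) U (r ∷ᵉ []ᵉ) λ (r′ , h) →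
    k (r′ , (λ v p → proj₁ (proj₁ (h v) p)) , λ x p y q →
      (λ (y∈x , m) → y∈x , λ k → m λ (v , v∈r , d) → k (v , proj₂ (h v) (proj₂ nU s s∈U v (Doub-⊆ p q d) , v∈r) , d)) ,
      (λ (y∈x , m) → y∈x , λ k → m λ (v , v∈r′ , d) → k (v , proj₂ (proj₁ (h v) v∈r′) , d)))

-- Forcing

interpret : ∀ {m n} → Fm ℒR n → (Fin n → Fin m) → Fin m → Fm ℒ∈ m
interpret (x ∈̇ y) σ r = σ x ∈̇ σ y
interpret (x ≐ y) σ r = σ x ≐ σ y
interpret (Ṙ x y) σ r = chooses r (σ x) (σ y)
interpret (φ ∧̇ ψ) σ r = interpret φ σ r ∧̇ interpret ψ σ r
interpret (φ ∨̇ ψ) σ r = interpret φ σ r ∨̇ interpret ψ σ r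
interpret (φ ⇒ ψ) σ r = interpret φ σ r ⇒ interpret ψ σ r
interpret (¬̇ φ)   σ r = ¬̇ (interpret φ σ r)
interpret (∀̇ φ)   σ r = ∀̇ (interpret φ (ext σ) (suc r))
interpret (∃̇ φ)   σ r = ∃̇ (interpret φ (ext σ) (suc r))

interpret-Δ : ∀ {m n} {φ : Fm ℒR n} {σ : Fin n → Fin m} {r} → Δ₀ᴾ φ → Δ₀ᴾ (interpret φ σ r)
interpret-Δ (∈-at x y) = ∈-at _ _
interpret-Δ (≐-at x y) = ≐-at _ _
interpret-Δ (R-at x y) = chooses-Δ _ _ _
interpret-Δ (∧-c d e)  = ∧-c (interpret-Δ d) (interpret-Δ e)
interpret-Δ (∨-c d e)  = ∨-c (interpret-Δ d) (interpret-Δ e)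
interpret-Δ (⇒-c d e)  = ⇒-c (interpret-Δ d) (interpret-Δ e)
interpret-Δ (¬-c d)    = ¬-c (interpret-Δ d)
interpret-Δ (∀∈-c a d) = ∀∈-c _ (interpret-Δ d)
interpret-Δ (∃∈-c a d) = ∃∈-c _ (interpret-Δ d)
interpret-Δ (∀⊆-c a d) = ∀⊆-c _ (interpret-Δ d)
interpret-Δ (∃⊆-c a d) = ∃⊆-c _ (interpret-Δ d)

↑³ : ∀ {n} → Fin n → Fin (suc (suc (suc n)))
↑³ i = suc (suc (suc i))

module Interpretation (𝔐 : Model) where
  open Semantics 𝔐
  open Pairs 𝔐 using (Choice; Choice-≈)

  ⟦interpret⟧ : ∀ {m n} (φ : Fm ℒR n) {σ : Fin n → Fin m} {r} {ρ : Fin m → D} {ρ′} → (∀ i → Eq (ρ (σ i)) (ρ′ i)) →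
                (ρ ⊨ interpret φ σ r) ↔ ⟦ φ ⟧ (Choice (ρ r)) ρ′
  ⟦interpret⟧ (x ∈̇ y) h = Mem-≈ (h x) (h y)
  ⟦interpret⟧ (x ≐ y) h = Eq-≈ (h x) (h y)
  ⟦interpret⟧ (Ṙ x y) h = Choice-≈ (h x) (h y)
  ⟦interpret⟧ (φ ∧̇ ψ) h = ⟦interpret⟧ φ h ×↔ ⟦interpret⟧ ψ h
  ⟦interpret⟧ (φ ∨̇ ψ) h = M⊎↔ (⟦interpret⟧ φ h) (⟦interpret⟧ ψ h)
  ⟦interpret⟧ (φ ⇒ ψ) h = ⟦interpret⟧ φ h →↔ ⟦interpret⟧ ψ h
  ⟦interpret⟧ (¬̇ φ)   h = ⟦interpret⟧ φ h →↔ ↔-id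
  ⟦interpret⟧ (∀̇ φ)   h = Π↔ λ d → ⟦interpret⟧ φ (∷ᵉ-≈ h d)
  ⟦interpret⟧ (∃̇ φ)   h = MΣ↔ λ d → ⟦interpret⟧ φ (∷ᵉ-≈ h d)

  -- Members and subsets of elements of a nice set stay in it, so no bounded quantifier leads out of
  -- `s`.
  ⟦⟧-local : ∀ {n s} {φ : Fm ℒR n} {R R′ : Rel} → Δ₀ᴾ φ → Nice s →
             (∀ x → x ε s → ∀ y → y ε s → R x y ↔ R′ x y) →
             ∀ {ρ} → (∀ i → ρ i ε s) → ⟦ φ ⟧ R ρ → ⟦ φ ⟧ R′ ρ
  ⟦⟧-local {s = s} {R = R} {R′} δ ns a = go δ a
    where
    Same : Rel → Rel → Set
    Same R R′ = ∀ x → x ε s → ∀ y → y ε s → R x y ↔ R′ x y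
    flip′ : ∀ {R R′} → Same R R′ → Same R′ R
    flip′ a x p y q = proj₂ (a x p y q) , proj₁ (a x p y q)
    go : ∀ {n} {φ : Fm ℒR n} {R R′} → Δ₀ᴾ φ → Same R R′ → ∀ {ρ} → (∀ i → ρ i ε s) → ⟦ φ ⟧ R ρ → ⟦ φ ⟧ R′ ρ
    go (∈-at x y) a h p = p
    go (≐-at x y) a h p = p
    go (R-at x y) a h p = proj₁ (a _ (h x) _ (h y)) p
    go (∧-c d e)  a h (p , q) = go d a h p , go e a h q
    go (∨-c d e)  a h m k = m λ { (inj₁ p) → k (inj₁ (go d a h p)) ; (inj₂ q) → k (inj₂ (go e a h q)) }
    go (⇒-c d e)  a h f p = go e a h (f (go d (flip′ a) h p))
    go (¬-c d)    a h f p = f (go d (flip′ a) h p)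
    go (∀∈-c v d) a h f x p = go d a (proj₁ ns _ (h v) x p ∷ˢ h) (f x p)
    go (∃∈-c v d) a h m k = m λ (x , p , q) → k (x , p , go d a (proj₁ ns _ (h v) x p ∷ˢ h) q)
    go (∀⊆-c v d) a h f x p = go d a (proj₂ ns _ (h v) x p ∷ˢ h) (f x p)
    go (∃⊆-c v d) a h m k = m λ (x , p , q) → k (x , p , go d a (proj₂ ns _ (h v) x p ∷ˢ h) q)

-- Each code t names an instance of a promise "∀ y. ¬ G(y, …)"; the formula says, of (r, y, t), that the
-- choice relation r violates the promise t at y.
record Promise (𝔐 : Model) : Set where
  open Semantics 𝔐
  open Pairs 𝔐
  field
    formula : Fm ℒ∈ 3
    bounded : Δ₀ᴾ formula
  Violates : D → D → D → Set
  Violates r y t = r ∷ᵉ y ∷ᵉ t ∷ᵉ []ᵉ ⊨ formula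
  field
    local : ∀ {s r r′ y t} → Nice s → Agree s r r′ → y ε s → t ε s → Violates r y t → Violates r′ y t

module Forcing (𝔐 : Model) (𝔓 : Promise 𝔐) where
  open Semantics 𝔐
  open Pairs 𝔐
  open Promise 𝔓 using (Violates) renaming (formula to violates; bounded to violates-Δ; local to Violates-local)

  -- A promise binds on s only if its code lies in s. Then `Violates-local` applies, so keeping it
  -- depends only on the choice relation within s.
  keeps ok : ∀ {n} → Fin n → Fin n → Fin n → Fm ℒ∈ n
  keeps s r w = ∀∈ w (∀∈ (suc s) (# 1 ∈̇ suc (suc s) ⇒ ¬̇ (ren (suc (suc r) ∷ᵉ # 0 ∷ᵉ # 1 ∷ᵉ []ᵉ) violates)))
  ok s r w = functional s r ∧̇ total s r ∧̇ keeps s r w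

  ok-Δ : ∀ {n} (s r w : Fin n) → Δ₀ᴾ (ok s r w)
  ok-Δ s r w = ∧-c (functional-Δ _ _) (∧-c (total-Δ _ _)
    (∀∈-c _ (∀∈-c _ (⇒-c (∈-at _ _) (¬-c (Δ-ren violates-Δ))))))

  Keeps Ok : D → D → D → Set
  Keeps s r w = ∀ t → t ε w → ∀ y → y ε s → t ε s → Violates r y t → B
  Ok s r w = Functional s r × Total s r × Keeps s r w

  ⊨-ok : ∀ {n} {s r w : Fin n} {ρ} → (ρ ⊨ ok s r w) ↔ Ok (ρ s) (ρ r) (ρ w)
  ⊨-ok {s = s} {r} {w} {ρ} =
    (λ (f , g , h) → f , g , λ t p y q p′ v → h t p y q p′ (proj₂ (same y t) v)) ,
    (λ (f , g , h) → f , g , λ t p y q p′ v → h t p y q p′ (proj₁ (same y t) v))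
    where
    same : ∀ y t → (y ∷ᵉ t ∷ᵉ ρ ⊨ ren (suc (suc r) ∷ᵉ # 0 ∷ᵉ # 1 ∷ᵉ []ᵉ) violates) ↔ Violates (ρ r) y t
    same y t = ⊨-ren violates λ { zero → Eq-refl ; (suc zero) → Eq-refl ; (suc (suc zero)) → Eq-refl }

  -- ⟨ s , r , w ⟩ prescribes R on s by r; it is a condition if r extends to every larger nice set so
  -- that the promises in w are kept there.
  record Point : Set where
    constructor ⟨_,_,_⟩
    field dom rel prm : D
  open Point public

  infix 4 _≼_
  _≼_ : Point → Point → Set
  q ≼ p = dom p ⊆ dom q × prm p ⊆ prm q × Agree (dom p) (rel p) (rel q)

  -- `U` turns the quantifier over `r′` into a ⊆-bounded one without loss, because `restrict` moves
  -- any relation on `s′` into `U`. Only `s′` and `U` are quantified unboundedly.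
  Cond : Point → Set
  Cond ⟨ s , r , w ⟩ = Nice s × (∀ s′ U → Nice s′ → Nice U → s ⊆ s′ → s′ ε U →
    M (Σ D λ r′ → r′ ⊆ U × Agree s r r′ × Ok s′ r′ w))

  ≼-refl : ∀ {p} → p ≼ p
  ≼-refl = (λ _ h → h) , (λ _ h → h) , λ _ _ _ _ → id , id

  ≼-trans : ∀ {p q o} → q ≼ p → o ≼ q → o ≼ p
  ≼-trans (h , i , a) (h′ , i′ , a′) = (λ x → h′ x ∘ h x) , (λ x → i′ x ∘ i x) , Agree-trans a (Agree-⊆ h a′)

  Below : Point → (Point → Set) → Set
  Below p X = ∀ q → Cond q → q ≼ p → X q

  Below-≼ : ∀ {p q} {X : Point → Set} → q ≼ p → Below p X → Below q X
  Below-≼ l b o c l′ = b o c (≼-trans l l′)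

  cond : ∀ {n} → Fin n → Fin n → Fin n → Fm ℒ∈ n
  cond s r w = nice s ∧̇ ∀̇ (∀̇ (nice (# 1) ⇒ nice (# 0) ⇒ suc (suc s) ⊆̇ # 1 ⇒ # 1 ∈̇ # 0 ⇒
    ∃̇ (# 0 ⊆̇ # 1 ∧̇ agree (↑³ s) (↑³ r) (# 0) ∧̇ ok (# 2) (# 0) (↑³ w))))

  below : ∀ {n} → Fin n → Fin n → Fin n → Fm ℒ∈ (suc (suc (suc n))) → Fm ℒ∈ n
  below s r w φ = ∀̇ (∀̇ (∀̇ (cond (# 2) (# 1) (# 0) ⇒
    ↑³ s ⊆̇ # 2 ∧̇ ↑³ w ⊆̇ # 0 ∧̇ agree (↑³ s) (↑³ r) (# 1) ⇒ φ)))

  ⊨-cond : ∀ {n} {s r w : Fin n} {ρ} → (ρ ⊨ cond s r w) ↔ Cond ⟨ ρ s , ρ r , ρ w ⟩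
  ⊨-cond {s = s} {r} {w} {ρ} = ↔-id ×↔ Π↔ λ s′ → Π↔ λ U → ↔-id →↔ ↔-id →↔ ↔-id →↔ ↔-id →↔
    MΣ↔ λ r′ → ↔-id ×↔ ↔-id ×↔ ⊨-ok {s = # 2} {# 0} {↑³ w} {r′ ∷ᵉ U ∷ᵉ s′ ∷ᵉ ρ}

  ⊨-below : ∀ {n} (s r w : Fin n) φ {ρ} {X : Point → Set} →
    (∀ q → (prm q ∷ᵉ rel q ∷ᵉ dom q ∷ᵉ ρ ⊨ φ) ↔ X q) → (ρ ⊨ below s r w φ) ↔ Below ⟨ ρ s , ρ r , ρ w ⟩ X
  ⊨-below s r w φ {ρ} h =
    (λ f q c l → proj₁ (h q) (f (dom q) (rel q) (prm q) (proj₂ (same q) c) l)) ,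
    (λ f s′ r′ w′ c l → let q = ⟨ s′ , r′ , w′ ⟩ in proj₂ (h q) (f q (proj₁ (same q) c) l))
    where
    same : ∀ q → (prm q ∷ᵉ rel q ∷ᵉ dom q ∷ᵉ ρ ⊨ cond (# 2) (# 1) (# 0)) ↔ Cond q
    same q = ⊨-cond {s = # 2} {# 1} {# 0} {prm q ∷ᵉ rel q ∷ᵉ dom q ∷ᵉ ρ}

  -- Weak forcing. No sets are added, so the elements of the ground model serve as names.
  Force : ∀ {n} → Fm ℒR n → (Fin n → D) → Point → Set
  Force (x ∈̇ y) ρ p = ρ x ε ρ y
  Force (x ≐ y) ρ p = Eq (ρ x) (ρ y)
  -- A condition whose domain lacks one of the two sets is silent about them; `extendᵉ` always finds
  -- a stronger one that speaks.
  Force (Ṙ x y) ρ p = Below p λ q → ρ x ε dom q → ρ y ε dom q → Choice (rel q) (ρ x) (ρ y)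
  Force (φ ∧̇ ψ) ρ p = Force φ ρ p × Force ψ ρ p
  Force (φ ∨̇ ψ) ρ p = Below p λ q → Below q (λ o → Force φ ρ o → B) → Below q (λ o → Force ψ ρ o → B) → B
  Force (φ ⇒ ψ) ρ p = Below p λ q → Force φ ρ q → Force ψ ρ q
  Force (¬̇ φ)   ρ p = Below p λ q → Force φ ρ q → B
  Force (∀̇ φ)   ρ p = ∀ d → Force φ (d ∷ᵉ ρ) p
  Force (∃̇ φ)   ρ p = Below p λ q → Below q (λ o → ∀ d → Force φ (d ∷ᵉ ρ) o → B) → B

  -- Definability of forcing in the ground language, for the sake of set induction in `Force-ind`.
  force : ∀ {m n} → Fm ℒR n → (Fin n → Fin m) → Fin m → Fin m → Fin m → Fm ℒ∈ m
  force (x ∈̇ y) σ s r w = σ x ∈̇ σ y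
  force (x ≐ y) σ s r w = σ x ≐ σ y
  force (Ṙ x y) σ s r w = below s r w (↑³ (σ x) ∈̇ # 2 ⇒ ↑³ (σ y) ∈̇ # 2 ⇒
                            chooses (# 1) (↑³ (σ x)) (↑³ (σ y)))
  force (φ ∧̇ ψ) σ s r w = force φ σ s r w ∧̇ force ψ σ s r w
  force (φ ∨̇ ψ) σ s r w = below s r w
    (below (# 2) (# 1) (# 0) (¬̇ (force φ (↑³ ∘ ↑³ ∘ σ) (# 2) (# 1) (# 0))) ⇒
      ¬̇ (below (# 2) (# 1) (# 0) (¬̇ (force ψ (↑³ ∘ ↑³ ∘ σ) (# 2) (# 1) (# 0)))))
  force (φ ⇒ ψ) σ s r w = below s r w
    (force φ (↑³ ∘ σ) (# 2) (# 1) (# 0) ⇒ force ψ (↑³ ∘ σ) (# 2) (# 1) (# 0))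
  force (¬̇ φ)   σ s r w = below s r w (¬̇ (force φ (↑³ ∘ σ) (# 2) (# 1) (# 0)))
  force (∀̇ φ)   σ s r w = ∀̇ (force φ (ext σ) (suc s) (suc r) (suc w))
  force (∃̇ φ)   σ s r w = below s r w
    (¬̇ (below (# 2) (# 1) (# 0) (∀̇ (¬̇ (force φ (ext (↑³ ∘ ↑³ ∘ σ)) (# 3) (# 2) (# 1))))))

  ⊨-force : ∀ {m n} (φ : Fm ℒR n) {σ : Fin n → Fin m} {s r w} {ρ : Fin m → D} {ρ′} → (∀ i → Eq (ρ (σ i)) (ρ′ i)) →
            (ρ ⊨ force φ σ s r w) ↔ Force φ ρ′ ⟨ ρ s , ρ r , ρ w ⟩
  ⊨-force (x ∈̇ y) h = Mem-≈ (h x) (h y)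
  ⊨-force (x ≐ y) h = Eq-≈ (h x) (h y)
  ⊨-force (Ṙ x y) {σ} {s} {r} {w} h =
    ⊨-below s r w (↑³ (σ x) ∈̇ # 2 ⇒ ↑³ (σ y) ∈̇ # 2 ⇒ chooses (# 1) (↑³ (σ x)) (↑³ (σ y)))
      λ q → Mem-≈ (h x) Eq-refl →↔ Mem-≈ (h y) Eq-refl →↔ Choice-≈ (h x) (h y)
  ⊨-force (φ ∧̇ ψ) h = ⊨-force φ h ×↔ ⊨-force ψ h
  ⊨-force {m} {n} (φ ∨̇ ψ) {σ} {s} {r} {w} h =
    ⊨-below s r w (refuted φ ⇒ ¬̇ (refuted ψ)) λ q →
      ⊨-below (# 2) (# 1) (# 0) (refuted′ φ) (λ o → ⊨-force φ h →↔ ↔-id) →↔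
      ⊨-below (# 2) (# 1) (# 0) (refuted′ ψ) (λ o → ⊨-force ψ h →↔ ↔-id) →↔ ↔-id
    where
    refuted′ : Fm ℒR n → Fm ℒ∈ _
    refuted′ χ = ¬̇ (force χ (↑³ ∘ ↑³ ∘ σ) (# 2) (# 1) (# 0))
    refuted : Fm ℒR n → Fm ℒ∈ (suc (suc (suc m)))
    refuted χ = below (# 2) (# 1) (# 0) (refuted′ χ)
  ⊨-force (φ ⇒ ψ) {σ} {s} {r} {w} h =
    ⊨-below s r w (force φ (↑³ ∘ σ) (# 2) (# 1) (# 0) ⇒ force ψ (↑³ ∘ σ) (# 2) (# 1) (# 0))
      λ q → ⊨-force φ h →↔ ⊨-force ψ h
  ⊨-force (¬̇ φ) {σ} {s} {r} {w} h =
    ⊨-below s r w (¬̇ (force φ (↑³ ∘ σ) (# 2) (# 1) (# 0))) λ q → ⊨-force φ h →↔ ↔-id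
  ⊨-force (∀̇ φ) h = Π↔ λ d → ⊨-force φ (∷ᵉ-≈ h d)
  ⊨-force {m} (∃̇ φ) {σ} {s} {r} {w} h =
    ⊨-below s r w (¬̇ (below (# 2) (# 1) (# 0) refuted)) λ q →
      ⊨-below (# 2) (# 1) (# 0) refuted (λ o → Π↔ λ d → ⊨-force φ (∷ᵉ-≈ h d) →↔ ↔-id) →↔ ↔-id
    where
    refuted : Fm ℒ∈ (suc (suc (suc (suc (suc (suc m))))))
    refuted = ∀̇ (¬̇ (force φ (ext (↑³ ∘ ↑³ ∘ σ)) (# 3) (# 2) (# 1)))

  Below↔ : ∀ {p} {X Y : Point → Set} → (∀ q → Cond q → X q ↔ Y q) → Below p X ↔ Below p Y
  Below↔ h = Π↔ λ q → (λ f c l → proj₁ (h q c) (f c l)) , λ f c l → proj₂ (h q c) (f c l)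

  Force-ren : ∀ {m n} (φ : Fm ℒR m) {σ : Fin m → Fin n} {ρ ρ′ p} → (∀ i → Eq (ρ (σ i)) (ρ′ i)) →
              Force (ren σ φ) ρ p ↔ Force φ ρ′ p
  Force-ren (x ∈̇ y) h = Mem-≈ (h x) (h y)
  Force-ren (x ≐ y) h = Eq-≈ (h x) (h y)
  Force-ren (Ṙ x y) h = Below↔ λ q _ → Mem-≈ (h x) Eq-refl →↔ Mem-≈ (h y) Eq-refl →↔ Choice-≈ (h x) (h y)
  Force-ren (φ ∧̇ ψ) h = Force-ren φ h ×↔ Force-ren ψ h
  Force-ren (φ ∨̇ ψ) h = Below↔ λ q _ → Below↔ (λ o _ → Force-ren φ h →↔ ↔-id) →↔ Below↔ (λ o _ → Force-ren ψ h →↔ ↔-id) →↔ ↔-id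
  Force-ren (φ ⇒ ψ) h = Below↔ λ q _ → Force-ren φ h →↔ Force-ren ψ h
  Force-ren (¬̇ φ)   h = Below↔ λ q _ → Force-ren φ h →↔ ↔-id
  Force-ren (∀̇ φ)   h = Π↔ λ d → Force-ren φ (∷ᵉ-≈ h d)
  Force-ren (∃̇ φ)   h = Below↔ λ q _ → Below↔ (λ o _ → Π↔ λ d → Force-ren φ (∷ᵉ-≈ h d) →↔ ↔-id) →↔ ↔-id

  Force-cong : ∀ {n} (φ : Fm ℒR n) {ρ ρ′ p} → (∀ i → Eq (ρ i) (ρ′ i)) → Force φ ρ p → Force φ ρ′ p
  Force-cong φ h f = proj₁ (Force-ren φ {σ = id} h) (proj₂ (Force-ren φ {σ = id} λ _ → Eq-refl) f)

  Force-inst : ∀ {n} (φ : Fm ℒR (suc n)) {ρ p} t → Force (φ [ t ]) ρ p ↔ Force φ (ρ t ∷ᵉ ρ) p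
  Force-inst φ t = Force-ren φ λ { zero → Eq-refl ; (suc i) → Eq-refl }

  Force-mono : ∀ {n} (φ : Fm ℒR n) {ρ p q} → q ≼ p → Force φ ρ p → Force φ ρ q
  Force-mono (x ∈̇ y) l f = f
  Force-mono (x ≐ y) l f = f
  Force-mono (Ṙ x y) l f = Below-≼ l f
  Force-mono (φ ∧̇ ψ) l (f , g) = Force-mono φ l f , Force-mono ψ l g
  Force-mono (φ ∨̇ ψ) l f = Below-≼ l f
  Force-mono (φ ⇒ ψ) l f = Below-≼ l f
  Force-mono (¬̇ φ)   l f = Below-≼ l f
  Force-mono (∀̇ φ)   l f d = Force-mono φ l (f d)
  Force-mono (∃̇ φ)   l f = Below-≼ l f

  Densely : Point → (Point → Set) → Set
  Densely p X = Below p λ q → Below q (λ o → X o → B) → B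

  -- Supplies the classical reasoning in `sound`: the premises of `¬¬E`, `∨E` and `∃E` force the
  -- conclusion only densely below a condition.
  Force-dense : ∀ {n} (φ : Fm ℒR n) {ρ p} → Cond p → Densely p (Force φ ρ) → Force φ ρ p
  Force-dense (x ∈̇ y) c h = Mem-stable λ k → h _ c ≼-refl λ o c′ l f → k f
  Force-dense (x ≐ y) c h = Eq-stable λ k → h _ c ≼-refl λ o c′ l f → k f
  Force-dense (Ṙ x y) c h q c₁ l i j = Choice-stable λ k → h q c₁ l λ o c′ (l₁ , l₂ , a) f →
    k (proj₂ (a _ i _ j) (f o c′ ≼-refl (l₁ _ i) (l₁ _ j)))
  Force-dense (φ ∧̇ ψ) c h = Force-dense φ c (λ q c l k → h q c l λ o c′ l′ (f , _) → k o c′ l′ f) ,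
                            Force-dense ψ c (λ q c l k → h q c l λ o c′ l′ (_ , f) → k o c′ l′ f)
  Force-dense (φ ∨̇ ψ) c h q c₁ l a b = h q c₁ l λ o c′ l′ f → f o c′ ≼-refl (Below-≼ l′ a) (Below-≼ l′ b)
  Force-dense (φ ⇒ ψ) c h q c₁ l g = Force-dense ψ c₁ λ o c′ l′ k → h o c′ (≼-trans l l′) λ o′ c″ l″ f →
    k o′ c″ l″ (f o′ c″ ≼-refl (Force-mono φ (≼-trans l′ l″) g))
  Force-dense (¬̇ φ)   c h q c₁ l g = h q c₁ l λ o c′ l′ f → f o c′ ≼-refl (Force-mono φ l′ g)
  Force-dense (∀̇ φ)   c h d = Force-dense φ c λ q c₁ l k → h q c₁ l λ o c′ l′ f → k o c′ l′ (f d)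
  Force-dense (∃̇ φ)   c h q c₁ l a = h q c₁ l λ o c′ l′ f → f o c′ ≼-refl (Below-≼ l′ a)

  Forces : ∀ {n} → List (Fm ℒR n) → (Fin n → D) → Point → Set
  Forces Γ ρ p = ∀ {ψ} → ψ ∈ Γ → Force ψ ρ p

  sound : ∀ {n} {Γ : List (Fm ℒR n)} {φ} → Γ ⊢ φ → ∀ {ρ p} → Cond p → Forces Γ ρ p → Force φ ρ p
  sound {Γ = Γ} d₀ {ρ} {p} c h = go d₀
    where
    hyp-mono : ∀ {q ψ} → q ≼ p → ψ ∈ Γ → Force ψ ρ q
    hyp-mono {ψ = ψ} l i = Force-mono ψ l (h i)
    under : ∀ {q χ} → q ≼ p → Force χ ρ q → Forces (χ ∷ Γ) ρ q
    under l f (here refl)   = f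
    under l f (there i)     = hyp-mono l i
    weak : ∀ {q} d → q ≼ p → Forces (map wk Γ) (d ∷ᵉ ρ) q
    weak d l i with ∈-map⁻ wk i
    ... | ψ , j , refl = proj₂ (Force-ren ψ λ _ → Eq-refl) (Force-mono ψ l (h j))
    weak+ : ∀ {q χ} d → q ≼ p → Force χ (d ∷ᵉ ρ) q → Forces (χ ∷ map wk Γ) (d ∷ᵉ ρ) q
    weak+ d l f (here refl) = f
    weak+ d l f (there i)   = weak d l i
    go : ∀ {φ} → Γ ⊢ φ → Force φ ρ p
    go (hyp i)      = h i
    go (∧I d e)     = go d , go e
    go (∧E₁ d)      = proj₁ (go d)
    go (∧E₂ d)      = proj₂ (go d)
    go (∨I₁ {φ} d)  q c′ l a b = a q c′ ≼-refl (Force-mono φ l (go d))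
    go (∨I₂ {ψ = ψ} d) q c′ l a b = b q c′ ≼-refl (Force-mono ψ l (go d))
    go (∨E {χ = χ} d e f) = Force-dense χ c λ q c₁ l k → go d q c₁ l
      (λ o c′ l′ g → k o c′ l′ (sound e c′ (under (≼-trans l l′) g)))
      (λ o c′ l′ g → k o c′ l′ (sound f c′ (under (≼-trans l l′) g)))
    go (⇒I d)       q c′ l f = sound d c′ (under l f)
    go (⇒E d e)     = go d p c ≼-refl (go e)
    go (¬I d e)     q c′ l f = sound e c′ (under l f) q c′ ≼-refl (sound d c′ (under l f))
    go (¬E {ψ} {χ} d e) = Force-dense χ c λ q c′ l k → go e q c′ l (Force-mono ψ l (go d))
    go (¬¬E {φ} d)  = Force-dense φ c λ q c′ l k → go d q c′ l k
    go (∀I d)       x = sound d c (weak x ≼-refl)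
    go (∀E {φ} d t) = proj₂ (Force-inst φ t) (go d (ρ t))
    go (∃I {φ} t d) q c′ l k = k q c′ ≼-refl (ρ t) (Force-mono φ l (proj₁ (Force-inst φ t) (go d)))
    go (∃E {φ} {χ} d e) = Force-dense χ c λ q c₁ l k → go d q c₁ l λ o c′ l′ x f →
      k o c′ l′ (proj₁ (Force-ren χ λ _ → Eq-refl) (sound e c′ (weak+ x (≼-trans l l′) f)))
    go nonempty     q c′ l k = k q c′ ≼-refl point Eq-refl
    go (≐refl t)    = Eq-refl
    go (≐E {φ} {s} {t} d e) = proj₂ (Force-inst φ t)
      (Force-cong φ (λ { zero → go d ; (suc i) → Eq-refl }) (proj₁ (Force-inst φ s) (go e)))

  -- Names are the sets of the ground model themselves, so formulas without `Ṙ` keep their meaning.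
  -- This brings forced conclusions back to the model.
  Force-embed : ∀ {n} (φ : Fm ℒ∈ n) {ρ p} → Cond p → Force (embed φ) ρ p ↔ (ρ ⊨ φ)
  Force-embed (x ∈̇ y) c = id , id
  Force-embed (x ≐ y) c = id , id
  Force-embed (φ ∧̇ ψ) c = (λ (f , g) → proj₁ (Force-embed φ c) f , proj₁ (Force-embed ψ c) g) ,
                          (λ (f , g) → proj₂ (Force-embed φ c) f , proj₂ (Force-embed ψ c) g)
  Force-embed (φ ∨̇ ψ) c =
    (λ f k → f _ c ≼-refl (λ o c′ l g → k (inj₁ (proj₁ (Force-embed φ c′) g))) (λ o c′ l g → k (inj₂ (proj₁ (Force-embed ψ c′) g)))) ,
    (λ m q c′ l a b → m λ { (inj₁ x) → a q c′ ≼-refl (proj₂ (Force-embed φ c′) x) ; (inj₂ x) → b q c′ ≼-refl (proj₂ (Force-embed ψ c′) x) })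
  Force-embed (φ ⇒ ψ) c = (λ f x → proj₁ (Force-embed ψ c) (f _ c ≼-refl (proj₂ (Force-embed φ c) x))) ,
                          (λ f q c′ l g → proj₂ (Force-embed ψ c′) (f (proj₁ (Force-embed φ c′) g)))
  Force-embed (¬̇ φ)   c = (λ f x → f _ c ≼-refl (proj₂ (Force-embed φ c) x)) , (λ f q c′ l g → f (proj₁ (Force-embed φ c′) g))
  Force-embed (∀̇ φ)   c = (λ f d → proj₁ (Force-embed φ c) (f d)) , (λ f d → proj₂ (Force-embed φ c) (f d))
  Force-embed (∃̇ φ)   c = (λ f k → f _ c ≼-refl λ o c′ l d g → k (d , proj₁ (Force-embed φ c′) g)) ,
                          (λ m q c′ l a → m λ (d , x) → a q c′ ≼-refl d (proj₂ (Force-embed φ c′) x))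

-- Forcing the axioms

module Generic (𝔐 : Model) (holds : ∀ {C} → KPᴾ+AC C → Model._⊨_ 𝔐 []ᵉ C) (𝔓 : Promise 𝔐) where
  open Choices 𝔐 holds
  open Interpretation 𝔐
  open Forcing 𝔐 𝔓
  open Promise 𝔓 using (Violates) renaming (local to Violates-local)

  -- Both witnesses are put into one set, these sets are collected, and a nice set around the result
  -- contains all the witnesses by transitivity.
  collection₂ : ∀ {n} {G : Fm ℒ∈ (suc (suc (suc (suc n))))} → Δ₀ᴾ G → ∀ a (ρ : Fin n → D) →
    (∀ x → x ε a → M (Σ D λ y → Σ D λ z → z ∷ᵉ y ∷ᵉ x ∷ᵉ a ∷ᵉ ρ ⊨ G)) →
    M (Σ D λ v → Nice v × (∀ x → x ε a → M (Σ D λ y → Σ D λ z → y ε v × z ε v × (z ∷ᵉ y ∷ᵉ x ∷ᵉ a ∷ᵉ ρ ⊨ G))))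
  collection₂ {n} {G} δ a ρ h k =
    collection {G = ∃∈ (# 0) (∃∈ (# 1) (ren τ G))} (∃∈-c _ (∃∈-c _ (Δ-ren δ))) a ρ
      (λ x p k → h x p λ (y , z , g) → pairing y z λ (v , y∈v , z∈v , _) →
        k (v , λ k → k (y , y∈v , λ k → k (z , z∈v , proj₂ (⊨-ren G (same z y v x)) g)))) λ (Z , hZ) →
    nice-∋ Z λ (s , ns , Z∈s) → k (s , ns , λ x p k → hZ x p λ (v , v∈Z , m) → m λ (y , y∈v , m) → m λ (z , z∈v , g) →
      let v∈s = proj₁ ns Z Z∈s v v∈Z in
      k (y , z , proj₁ ns v v∈s y y∈v , proj₁ ns v v∈s z z∈v , proj₁ (⊨-ren G (same z y v x)) g))
    where
    τ : Fin (suc (suc (suc (suc n)))) → Fin (suc (suc (suc (suc (suc n)))))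
    τ zero          = zero
    τ (suc zero)    = suc zero
    τ (suc (suc i)) = suc (suc (suc i))
    same : ∀ z y v x i → Eq ((z ∷ᵉ y ∷ᵉ v ∷ᵉ x ∷ᵉ a ∷ᵉ ρ) (τ i)) ((z ∷ᵉ y ∷ᵉ x ∷ᵉ a ∷ᵉ ρ) i)
    same z y v x zero          = Eq-refl
    same z y v x (suc zero)    = Eq-refl
    same z y v x (suc (suc i)) = Eq-refl

  nice-∋₂ : ∀ x y → M (Σ D λ s → Nice s × x ε s × y ε s)
  nice-∋₂ x y k = pairing x y λ (v , p , q , _) → nice-∋ v λ (s , ns , r) →
    k (s , ns , proj₁ ns v r x p , proj₁ ns v r y q)

  adjoin : ∀ w t → M (Σ D λ w′ → w ⊆ w′ × t ε w′ × (∀ z → z ε w′ → M (z ε w ⊎ Eq z t)))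
  adjoin w t k = pairing t t λ (v , t∈v , _) → pairing w v λ (p , w∈p , v∈p , _) → holds (kp union) p λ (U , hU) →
    separation {φ = # 0 ∈̇ # 2 ∨̇ # 0 ≐ # 3} (∨-c (∈-at _ _) (≐-at _ _)) U (w ∷ᵉ t ∷ᵉ []ᵉ) λ (w′ , h) →
    k (w′ , (λ z q → proj₂ (h z) (hU w w∈p z q , λ k → k (inj₁ q)))
          , proj₂ (h t) (hU v v∈p t t∈v , λ k → k (inj₂ Eq-refl))
          , λ z q → proj₂ (proj₁ (h z) q))

  Ok-agree : ∀ {s r r′ w} → Nice s → Agree s r r′ → Ok s r w → Ok s r′ w
  Ok-agree ns a (f , t , h) =
    (λ x p y q z o c c′ → f x p y q z o (proj₂ (a x p y q) c) (proj₂ (a x p z o) c′)) ,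
    (λ x p u q k → t x p u q λ (y , y∈x , c) → k (y , y∈x , proj₁ (a x p y (proj₁ ns x p y y∈x)) c)) ,
    λ t p y q o v → h t p y q o (Violates-local ns (Agree-sym a) q o v)

  Ok-⊆ : ∀ {s s′ r w w′} → s′ ⊆ s → w′ ⊆ w → Ok s r w → Ok s′ r w′
  Ok-⊆ i j (f , t , h) =
    (λ x p y q z o → f x (i x p) y (i y q) z (i z o)) ,
    (λ x p → t x (i x p)) ,
    λ t p y q o → h t (j t p) y (i y q) (i t o)

  -- The domain is itself one of the nice sets to which the point extends, and agreement carries the
  -- properties back to `rel p`.
  Cond⇒Ok : ∀ {p} → Cond p → M (Ok (dom p) (rel p) (prm p))
  Cond⇒Ok (ns , h) k = nice-∋ _ λ (U , nU , s∈U) → h _ U ns nU (λ _ → id) s∈U λ (r′ , _ , a , o) →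
    k (Ok-agree ns (Agree-sym a) o)

  -- The existential form of failure; `s′` and `U` are the two witnesses that `collection₂` bounds.
  ¬Cond : ∀ {s r w} → Nice s → (Cond ⟨ s , r , w ⟩ → B) → M (Σ D λ s′ → Σ D λ U → Nice s′ × Nice U × s ⊆ s′ × s′ ε U ×
          (∀ r′ → r′ ⊆ U → Agree s r r′ × Ok s′ r′ w → B))
  ¬Cond ns h k = h (ns , λ s′ U ns′ nU s⊆s′ s′∈U k′ → k (s′ , U , ns′ , nU , s⊆s′ , s′∈U , λ r′ sub x → k′ (r′ , sub , x)))

  -- Pigeonhole: the restrictions to S of choice relations on larger nice sets form a set, so one of
  -- them is extendible to arbitrarily large nice sets.
  extend : ∀ {p S} → Cond p → Nice S → dom p ⊆ S →
           M (Σ D λ r → Cond ⟨ S , r , prm p ⟩ × Agree (dom p) (rel p) r)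
  extend {⟨ s , r , w ⟩} {S} (ns , h) nS s⊆S k =
    nice-∋ S λ (U , nU , S∈U) → power U λ (P , hP) →
    -- The pigeonholes: up to agreement on `S`, `A` contains every relation that agrees with `r` on
    -- `s`.
    separation {φ = agree (# 2) (# 3) (# 0)} (agree-Δ _ _ _) P (s ∷ᵉ r ∷ᵉ []ᵉ) λ (A , hA) →
    collection₂ {G = G} G-Δ A (w ∷ᵉ S ∷ᵉ []ᵉ)
      (λ r₁ r₁∈A k′ → ¬Cond nS (λ c → k (r₁ , c , proj₂ (proj₁ (hA r₁) r₁∈A))) λ (s₂ , U₂ , ns₂ , nU₂ , S⊆s₂ , s₂∈U₂ , bad) →
        k′ (s₂ , U₂ , ns₂ , nU₂ , S⊆s₂ , s₂∈U₂ , λ r₂ sub (a , o) →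
          bad r₂ sub (a , proj₁ (⊨-ok {s = # 2} {# 0} {# 5} {r₂ ∷ᵉ U₂ ∷ᵉ s₂ ∷ᵉ r₁ ∷ᵉ A ∷ᵉ w ∷ᵉ S ∷ᵉ []ᵉ}) o))) λ (z , nz , hz) →
    nice-∋₂ z S λ (T , nT , z∈T , S∈T) → nice-∋ T λ (V , nV , T∈V) →
    -- `T` includes every `s₂` in `z`. The extension `r*` to `T` restricts on `S` to some `r₁` in
    -- `A`, and its restriction to the `s₂` of this `r₁` is just what `bad` excludes.
    h T V nT nV (λ x p → proj₁ nT S S∈T x (s⊆S x p)) T∈V λ (r* , _ , a* , o*) →
    restrict nU S∈U r* λ (r₁ , r₁⊆U , a₁) →
    hz r₁ (proj₂ (hA r₁) (proj₂ (hP r₁) r₁⊆U , Agree-trans a* (Agree-⊆ s⊆S a₁)))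
      λ (s₂ , U₂ , s₂∈z , _ , ns₂ , nU₂ , S⊆s₂ , s₂∈U₂ , bad) →
    restrict nU₂ s₂∈U₂ r* λ (r₂ , r₂⊆U₂ , a₂) →
    bad r₂ r₂⊆U₂ (Agree-trans (Agree-sym a₁) (Agree-⊆ S⊆s₂ a₂) ,
      proj₂ (⊨-ok {s = # 2} {# 0} {# 5} {r₂ ∷ᵉ U₂ ∷ᵉ s₂ ∷ᵉ r₁ ∷ᵉ A ∷ᵉ w ∷ᵉ S ∷ᵉ []ᵉ})
        (Ok-agree ns₂ a₂ (Ok-⊆ (proj₁ nT s₂ (proj₁ nT z z∈T s₂ s₂∈z)) (λ _ → id) o*)))
    where
    G : Fm ℒ∈ 6
    G = nice (# 1) ∧̇ nice (# 0) ∧̇ # 5 ⊆̇ # 1 ∧̇ # 1 ∈̇ # 0 ∧̇ ∀⊆ (# 0) (¬̇ (agree (# 6) (# 3) (# 0) ∧̇ ok (# 2) (# 0) (# 5)))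
    G-Δ : Δ₀ᴾ G
    G-Δ = ∧-c (nice-Δ _) (∧-c (nice-Δ _) (∧-c (⊆-Δ _ _) (∧-c (∈-at _ _) (∀⊆-c _ (¬-c (∧-c (agree-Δ _ _ _) (ok-Δ _ _ _)))))))

  extendᵉ : ∀ {n} (ρ : Fin n → D) {p} → Cond p → M (Σ Point λ q → Cond q × q ≼ p × (∀ i → ρ i ε dom q))
  extendᵉ {zero}  ρ {p} c k = k (p , c , ≼-refl , λ ())
  extendᵉ {suc n} ρ {p} c k = extendᵉ (ρ ∘ suc) c λ (q , c₁ , l₁ , h₁) →
    nice-∋₂ (dom q) (ρ zero) λ (S , nS , d∈S , ρ₀∈S) →
    extend c₁ nS (proj₁ nS _ d∈S) λ (r , c₂ , a) →
    k (⟨ S , r , prm q ⟩ , c₂ , ≼-trans l₁ (proj₁ nS _ d∈S , (λ _ → id) , a)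
      , λ { zero → ρ₀∈S ; (suc i) → proj₁ nS _ d∈S _ (h₁ i) })

  -- Bounded quantifiers over parameters in the nice set `dom p` stay inside it, and there no
  -- stronger condition can change what `rel p` chooses.
  Force-Δ : ∀ {n} {φ : Fm ℒR n} → Δ₀ᴾ φ → ∀ {p q} → Nice (dom p) → Cond q → q ≼ p →
            ∀ {ρ} → (∀ i → ρ i ε dom p) → Force φ ρ q ↔ ⟦ φ ⟧ (Choice (rel p)) ρ
  Force-Δ δ {p} {q} np c l h = go δ c l h
    where
    -- The bound of a ⊆-quantifier is itself a formula containing an implication, which forcing
    -- interprets by `Below`.
    subset : ∀ {d e q} → Cond q → (∀ z → Below q λ _ → z ε d → z ε e) ↔ d ⊆ e
    subset c = (λ f z → f z _ c ≼-refl) , λ f z _ _ _ → f z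
    go : ∀ {n} {φ : Fm ℒR n} → Δ₀ᴾ φ → ∀ {q} → Cond q → q ≼ p →
         ∀ {ρ} → (∀ i → ρ i ε dom p) → Force φ ρ q ↔ ⟦ φ ⟧ (Choice (rel p)) ρ
    go (∈-at x y) c l h = ↔-id
    go (≐-at x y) c l h = ↔-id
    go (R-at x y) c (l , _ , a) h =
      (λ f → proj₂ (a _ (h x) _ (h y)) (f _ c ≼-refl (l _ (h x)) (l _ (h y)))) ,
      (λ f o c′ (l′ , _ , a′) i j → proj₁ (a′ _ (l _ (h x)) _ (l _ (h y))) (proj₁ (a _ (h x) _ (h y)) f))
    go (∧-c d e) c l h = go d c l h ×↔ go e c l h
    go (∨-c d e) c l h =
      (λ f k → f _ c ≼-refl (λ o c′ l′ g → k (inj₁ (proj₁ (go d c′ (≼-trans l l′) h) g)))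
                            (λ o c′ l′ g → k (inj₂ (proj₁ (go e c′ (≼-trans l l′) h) g)))) ,
      (λ m o c′ l′ f g → m λ { (inj₁ x) → f o c′ ≼-refl (proj₂ (go d c′ (≼-trans l l′) h) x)
                             ; (inj₂ x) → g o c′ ≼-refl (proj₂ (go e c′ (≼-trans l l′) h) x) })
    go (⇒-c d e) c l h =
      (λ f x → proj₁ (go e c l h) (f _ c ≼-refl (proj₂ (go d c l h) x))) ,
      (λ f o c′ l′ g → proj₂ (go e c′ (≼-trans l l′) h) (f (proj₁ (go d c′ (≼-trans l l′) h) g)))
    go (¬-c d) c l h =
      (λ f x → f _ c ≼-refl (proj₂ (go d c l h) x)) ,
      (λ f o c′ l′ g → f (proj₁ (go d c′ (≼-trans l l′) h) g))
    go (∀∈-c v d) c l h =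
      (λ f x p → proj₁ (go d c l (proj₁ np _ (h v) x p ∷ˢ h)) (f x _ c ≼-refl p)) ,
      (λ f x o c′ l′ p → proj₂ (go d c′ (≼-trans l l′) (proj₁ np _ (h v) x p ∷ˢ h)) (f x p))
    go (∃∈-c v d) c l h =
      (λ f k → f _ c ≼-refl λ o c′ l′ x (p , g) → k (x , p , proj₁ (go d c′ (≼-trans l l′) (proj₁ np _ (h v) x p ∷ˢ h)) g)) ,
      (λ m o c′ l′ f → m λ (x , p , g) → f o c′ ≼-refl x (p , proj₂ (go d c′ (≼-trans l l′) (proj₁ np _ (h v) x p ∷ˢ h)) g))
    go (∀⊆-c v d) c l h =
      (λ f x p → proj₁ (go d c l (proj₂ np _ (h v) x p ∷ˢ h)) (f x _ c ≼-refl (proj₂ (subset c) p))) ,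
      (λ f x o c′ l′ g → let p = proj₁ (subset c′) g in
        proj₂ (go d c′ (≼-trans l l′) (proj₂ np _ (h v) x p ∷ˢ h)) (f x p))
    go (∃⊆-c v d) c l h =
      (λ f k → f _ c ≼-refl λ o c′ l′ x (g , g′) → let p = proj₁ (subset c′) g in
        k (x , p , proj₁ (go d c′ (≼-trans l l′) (proj₂ np _ (h v) x p ∷ˢ h)) g′)) ,
      (λ m o c′ l′ f → m λ (x , p , g) →
        f o c′ ≼-refl x (proj₂ (subset c′) p , proj₂ (go d c′ (≼-trans l l′) (proj₂ np _ (h v) x p ∷ˢ h)) g))

  Force-close : ∀ n (φ : Fm ℒR n) {p} → (∀ ρ → Force φ ρ p) → Force (close n φ) []ᵉ p
  Force-close zero    φ h = h []ᵉ
  Force-close (suc n) φ h = Force-close n (∀̇ φ) λ ρ d → h (d ∷ᵉ ρ)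

  Force-gacFun : ∀ {p} → Cond p → Force gacFunAx []ᵉ p
  Force-gacFun c x y z q c₁ l (f , g) = Eq-stable λ k → extendᵉ (x ∷ᵉ y ∷ᵉ z ∷ᵉ []ᵉ) c₁ λ (o , c₂ , l′ , h) →
    Cond⇒Ok c₂ λ (fun , _) → k (fun x (h (# 0)) y (h (# 1)) z (h (# 2))
      (f o c₂ l′ (h (# 0)) (h (# 1))) (g o c₂ l′ (h (# 0)) (h (# 2))))

  Force-gacChoice : ∀ {p} → Cond p → Force gacChoiceAx []ᵉ p
  Force-gacChoice c x q c₁ l f o c₂ l′ k = extendᵉ (x ∷ᵉ []ᵉ) c₂ λ (o₁ , c₃ , l″ , h) → Cond⇒Ok c₃ λ (_ , tot , _) →
    f o₁ c₃ (≼-trans l′ l″) λ u o₂ c₄ l‴ u∈x → tot x (h (# 0)) u u∈x λ (y , y∈x , ch) →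
    k o₁ c₃ l″ y (y∈x , λ o₃ c₅ (_ , _ , a) _ _ → proj₁ (a x (h (# 0)) y (proj₁ (proj₁ c₃) x (h (# 0)) y y∈x)) ch)

  -- For a fixed condition, induction in the ground model is applied to the formula saying that this
  -- condition forces `φ`.
  Force-ind : ∀ n (φ : Fm ℒR (suc n)) {p} → Force (indAx n φ) []ᵉ p
  Force-ind n φ = Force-close n _ λ ρ q c l H a → proj₁ (meaning ρ q a)
    (induction (force φ σ (# 1) (# 2) (# 3)) (dom q ∷ᵉ rel q ∷ᵉ prm q ∷ᵉ ρ) (λ a ih →
      proj₂ (meaning ρ q a) (H a q c ≼-refl λ x o c′ l′ m →
        proj₂ (Force-ren φ λ { zero → Eq-refl ; (suc i) → Eq-refl }) (Force-mono φ l′ (proj₁ (meaning ρ q x) (ih x m))))) a)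
    where
    σ : Fin (suc n) → Fin (suc (suc (suc (suc n))))
    σ zero    = zero
    σ (suc i) = suc (suc (suc (suc i)))
    meaning : ∀ ρ q a → (a ∷ᵉ dom q ∷ᵉ rel q ∷ᵉ prm q ∷ᵉ ρ ⊨ force φ σ (# 1) (# 2) (# 3)) ↔ Force φ (a ∷ᵉ ρ) q
    meaning ρ q a = ⊨-force φ λ { zero → Eq-refl ; (suc i) → Eq-refl }

  -- Once the parameters lie in the domain, `Force-Δ` reads `φ` as a Δ₀ᴾ formula about the set
  -- `rel o`, and separation for it serves all stronger conditions at once.
  Force-sep : ∀ n (φ : Fm ℒR (suc (suc n))) → Δ₀ᴾ φ → ∀ {p} → Force (sepAx n φ) []ᵉ p
  Force-sep n φ δ = Force-close (suc n) _ λ ρ q c l k → extendᵉ ρ c λ (o , c₁ , l₁ , h) →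
    separation {φ = interpret φ σ (# 2)} (interpret-Δ δ) (ρ zero) (rel o ∷ᵉ ρ ∘ suc) λ (b , hb) →
    let
      same : ∀ u {o′} → Cond o′ → o′ ≼ o → u ε ρ zero →
        Force (ren (ext suc) φ) (u ∷ᵉ b ∷ᵉ ρ) o′ ↔ (u ∷ᵉ ρ zero ∷ᵉ rel o ∷ᵉ ρ ∘ suc ⊨ interpret φ σ (# 2))
      same u c′ l′ p =
        let
          f = Force-ren φ λ { zero → Eq-refl ; (suc i) → Eq-refl }
          g = Force-Δ δ {o} (proj₁ c₁) c′ l′ (proj₁ (proj₁ c₁) _ (h zero) u p ∷ˢ h)
          i = ⟦interpret⟧ φ {σ} {# 2} {u ∷ᵉ ρ zero ∷ᵉ rel o ∷ᵉ ρ ∘ suc}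
                λ { zero → Eq-refl ; (suc zero) → Eq-refl ; (suc (suc i)) → Eq-refl }
        in proj₂ i ∘ proj₁ g ∘ proj₁ f , proj₂ f ∘ proj₂ g ∘ proj₁ i
    in
    k o c₁ l₁ b λ u →
      (λ o′ c′ l′ u∈b → let p , x = proj₁ (hb u) u∈b in p , proj₂ (same u c′ l′ p) x) ,
      (λ o′ c′ l′ (p , f) → proj₂ (hb u) (p , proj₁ (same u c′ l′ p) f))
    where
    σ : Fin (suc (suc n)) → Fin (suc (suc (suc n)))
    σ zero          = zero
    σ (suc zero)    = suc zero
    σ (suc (suc i)) = suc (suc (suc i))

  Coded : ∀ {n} → Fm ℒR (suc n) → Set
  Coded {n} G = ∀ (e : Fin n → D) → M (Σ D λ t → ∀ r y → Violates r y t ↔ ⟦ G ⟧ (Choice r) (y ∷ᵉ e))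

  -- If q forces every x ∈ a to have a y with G(x, y), then promising that x has none is not a
  -- condition, and the failure shows at some s′; a bound for these s′ bounds the required y.
  Force-coll : ∀ n (G : Fm ℒR (suc (suc (suc n)))) → Δ₀ᴾ G → Coded G → ∀ {p} → Force (collAx n G) []ᵉ p
  Force-coll n G δ coded = Force-close (suc n) _ λ ρ p₁ c₁ l₁ H q c l k →
    extendᵉ ρ c λ (q₁ , cq₁ , lq₁ , h) →
    let
      a = ρ zero
      s = dom q₁
      r = rel q₁
      w = prm q₁
      ns = proj₁ cq₁
      x∈s : ∀ {x} → x ε a → x ε s
      x∈s = proj₁ ns a (h zero) _
      env : D → D → D → D → Fin (suc (suc (suc (suc (suc (suc (suc n))))))) → D
      env U′ s′ x a = U′ ∷ᵉ s′ ∷ᵉ x ∷ᵉ a ∷ᵉ s ∷ᵉ r ∷ᵉ w ∷ᵉ ρ ∘ suc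
      okay : ∀ {r′ U′ s′ x} → (r′ ∷ᵉ env U′ s′ x a ⊨ ok (# 2) (# 0) (# 7)) ↔ Ok s′ r′ w
      okay {r′} {U′} {s′} {x} = ⊨-ok {s = # 2} {# 0} {# 7} {r′ ∷ᵉ env U′ s′ x a}
      meaning : ∀ {y r′ U′ s′ x} → (y ∷ᵉ r′ ∷ᵉ env U′ s′ x a ⊨ interpret G σ (# 1)) ↔ ⟦ G ⟧ (Choice r′) (y ∷ᵉ x ∷ᵉ ρ)
      meaning {y} {r′} {U′} {s′} {x} = ⟦interpret⟧ G {σ} {# 1} {y ∷ᵉ r′ ∷ᵉ env U′ s′ x a}
        λ { zero → Eq-refl ; (suc zero) → Eq-refl ; (suc (suc zero)) → Eq-refl ; (suc (suc (suc i))) → Eq-refl }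
    in
    collection₂ {G = bad} bad-Δ a (s ∷ᵉ r ∷ᵉ w ∷ᵉ ρ ∘ suc)
      (λ x x∈a k → coded (x ∷ᵉ ρ) λ (t , ht) → adjoin w t λ (w′ , w⊆w′ , t∈w′ , w′⊆) →
        -- With the promise `t` added, a condition would still force a witness for `x`, so a
        -- stronger one would force `G` at some `y`. Once `y` and `t` are in its domain, the promise
        -- is broken.
        ¬Cond ns (λ c′ → let l′ = ≼-trans l (≼-trans lq₁ ((λ _ → id) , w⊆w′ , λ _ _ _ _ → ↔-id)) in
            H x ⟨ s , r , w′ ⟩ c′ l′ x∈a ⟨ s , r , w′ ⟩ c′ ≼-refl λ o co lo y f →
              extendᵉ (y ∷ᵉ t ∷ᵉ []ᵉ) co λ (o₁ , co₁ , lo₁ , h₁) →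
              let up : ∀ {z} → z ε s → z ε dom o₁
                  up z∈s = proj₁ lo₁ _ (proj₁ lo _ z∈s) in
              Cond⇒Ok co₁ λ (_ , _ , keeps) →
              keeps t (proj₁ (proj₂ lo₁) t (proj₁ (proj₂ lo) t t∈w′)) y (h₁ (# 0)) (h₁ (# 1))
                (proj₂ (ht (rel o₁) y) (proj₁ (Force-Δ δ {o₁} (proj₁ co₁) co₁ ≼-refl
                  (h₁ (# 0) ∷ˢ up (x∈s x∈a) ∷ˢ λ i → up (h i))) (Force-mono G lo₁ f))))
          λ (s′ , U′ , ns′ , nU′ , s⊆s′ , s′∈U′ , fails) →
        -- `bad` expresses the new promise directly, as absence of a `y` in `s′`; the code `t`,
        -- which varies with `x`, stays out of the collected formula.
        k (s′ , U′ , ns′ , nU′ , s⊆s′ , s′∈U′ , λ r′ r′⊆U′ (ag , o , none) →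
          let f , g , ks = proj₁ (okay {r′} {U′} {s′} {x}) o in
          fails r′ r′⊆U′ (ag , f , g , λ t′ t′∈w′ y y∈s′ t′∈s′ v → w′⊆ t′ t′∈w′ λ
            { (inj₁ t′∈w) → ks t′ t′∈w y y∈s′ t′∈s′ v
            ; (inj₂ t′≈t) → none y y∈s′ (proj₂ (meaning {y} {r′} {U′} {s′} {x})
                (proj₁ (ht r′ y) (Violates-cong t′≈t v))) })))
      λ (z , nz , hz) →
    -- `S` is the bound for the required `y`, as it includes every `s′` in `z`. It must also enter a
    -- domain as an element, for `Force-Δ` to take it as a parameter.
    nice-∋₂ z s λ (S , nS , z∈S , s∈S) → extend cq₁ nS (proj₁ nS s s∈S) λ (r₂ , c₂ , a₂) →
    extendᵉ (S ∷ᵉ []ᵉ) c₂ λ (q₃ , c₃ , l₃ , h₃) →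
    let
      l₂ = proj₁ nS s s∈S , (λ _ → id) , a₂
      s⊆d : s ⊆ dom q₃
      s⊆d = proj₁ (≼-trans {q₁} l₂ l₃)
    in
    k q₃ c₃ (≼-trans lq₁ (≼-trans {q₁} l₂ l₃)) S
      (proj₂ (Force-Δ (∀∈-c (# 1) (∃∈-c (# 1) (Δ-ren δ))) {q₃} (proj₁ c₃) c₃ ≼-refl {S ∷ᵉ ρ} (h₃ (# 0) ∷ˢ λ i → s⊆d _ (h i)))
        λ x x∈a k → hz x x∈a λ (s′ , U′ , s′∈z , _ , ns′ , nU′ , s⊆s′ , s′∈U′ , fails) →
        -- Cut down to `U′`, the relation of `q₃` agrees with `r` on `s` and keeps `w`. By `fails`
        -- it must have a witness in `s′`, and locality returns `G` to `rel q₃`.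
        restrict nU′ s′∈U′ (rel q₃) λ (r′ , r′⊆U′ , a′) → Cond⇒Ok c₃ λ o₃ →
        let s′⊆S = proj₁ nS s′ (proj₁ nS z z∈S s′ s′∈z) in
        fails r′ r′⊆U′
          ( Agree-trans (proj₂ (proj₂ (≼-trans {q₁} l₂ l₃))) (Agree-⊆ s⊆s′ a′)
          , proj₂ (okay {r′} {U′} {s′} {x}) (Ok-agree ns′ a′ (Ok-⊆ (λ y → proj₁ l₃ y ∘ s′⊆S y) (proj₁ (proj₂ l₃)) o₃))
          , λ y y∈s′ g → k (y , s′⊆S y y∈s′ , proj₂ (⟦ren⟧ G Choice-cong λ { zero → Eq-refl ; (suc zero) → Eq-refl ; (suc (suc i)) → Eq-refl })
              (⟦⟧-local δ ns′ (Agree-sym a′) (y∈s′ ∷ˢ s⊆s′ x (x∈s x∈a) ∷ˢ λ i → s⊆s′ _ (h i)) (proj₁ (meaning {y} {r′} {U′} {s′} {x}) g)))))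
    where
    Violates-cong : ∀ {r y t t′} → Eq t t′ → Violates r y t → Violates r y t′
    Violates-cong e = ⊨-cong (Promise.formula 𝔓) λ { zero → Eq-refl ; (suc zero) → Eq-refl ; (suc (suc zero)) → e }
    σ : Fin (suc (suc (suc n))) → Fin (suc (suc (suc (suc (suc (suc (suc (suc (suc n)))))))))
    σ zero                = # 0
    σ (suc zero)          = # 4
    σ (suc (suc zero))    = # 5
    σ (suc (suc (suc i))) = ↑³ (↑³ (↑³ i))
    bad : Fm ℒ∈ (suc (suc (suc (suc (suc (suc (suc n)))))))
    bad = nice (# 1) ∧̇ nice (# 0) ∧̇ # 4 ⊆̇ # 1 ∧̇ # 1 ∈̇ # 0 ∧̇ ∀⊆ (# 0) (¬̇
      (agree (# 5) (# 6) (# 0) ∧̇ ok (# 2) (# 0) (# 7) ∧̇ ∀∈ (# 2) (¬̇ (interpret G σ (# 1)))))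
    bad-Δ : Δ₀ᴾ bad
    bad-Δ = ∧-c (nice-Δ _) (∧-c (nice-Δ _) (∧-c (⊆-Δ _ _) (∧-c (∈-at _ _) (∀⊆-c _ (¬-c
      (∧-c (agree-Δ _ _ _) (∧-c (ok-Δ _ _ _) (∀∈-c _ (¬-c (interpret-Δ δ))))))))))

  -- `choice-∃` extends the empty point to any nice set, and with no promises made there are none to
  -- keep.
  initial : M (Σ Point Cond)
  initial k = separation {φ = ¬̇ (# 0 ≐ # 0)} (¬-c (≐-at _ _)) point []ᵉ λ (∅ , h) →
    let empty : ∀ {X : Set} z → z ε ∅ → (B → X) → X
        empty z p f = f (proj₂ (proj₁ (h z) p) Eq-refl)
    in
    k (⟨ ∅ , ∅ , ∅ ⟩
      , ((λ x p y q → empty x p λ b → Mem-stable λ _ → b) , (λ x p y q → empty x p λ b → Mem-stable λ _ → b))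
      , λ s′ U ns′ nU _ s′∈U k → choice-∃ ns′ nU s′∈U λ (r , r⊆U , f , t) →
          k (r , r⊆U , (λ x p y q → (λ c → Choice-stable λ _ → empty x p id) , λ c → Choice-stable λ _ → empty x p id)
            , f , t , λ t p y q _ _ → empty t p id))

-- Merging finitely many promises into one

module Promises (𝔐 : Model) (holds : ∀ {C} → KPᴾ+AC C → Model._⊨_ 𝔐 []ᵉ C) where
  open Choices 𝔐 holds
  open Interpretation 𝔐

  ⊨-stable : ∀ {n} (φ : Fm ℒ∈ n) {ρ} → M (ρ ⊨ φ) → ρ ⊨ φ
  ⊨-stable (x ∈̇ y) m = Mem-stable m
  ⊨-stable (x ≐ y) m = Eq-stable m
  ⊨-stable (φ ∧̇ ψ) m = ⊨-stable φ (λ k → m (k ∘ proj₁)) , ⊨-stable ψ (λ k → m (k ∘ proj₂))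
  ⊨-stable (φ ∨̇ ψ) m k = m λ p → p k
  ⊨-stable (φ ⇒ ψ) m p = ⊨-stable ψ λ k → m λ f → k (f p)
  ⊨-stable (¬̇ φ)   m p = m λ f → f p
  ⊨-stable (∀̇ φ)   m d = ⊨-stable φ λ k → m λ f → k (f d)
  ⊨-stable (∃̇ φ)   m k = m λ p → p k

  -- A promise with k parameters, not yet coded by a single set.
  record Template (k : ℕ) : Set where
    field
      formula : Fm ℒ∈ (suc (suc k))
      bounded : Δ₀ᴾ formula
    Holds : D → D → (Fin k → D) → Set
    Holds r y e = r ∷ᵉ y ∷ᵉ e ⊨ formula
    field
      local : ∀ {s r r′ y e} → Nice s → Agree s r r′ → y ε s → (∀ i → e i ε s) → Holds r y e → Holds r′ y e

    Holds-cong : ∀ {r y e e′} → (∀ i → Eq (e i) (e′ i)) → Holds r y e ↔ Holds r y e′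
    Holds-cong h = ⊨-cong formula (λ { zero → Eq-refl ; (suc zero) → Eq-refl ; (suc (suc i)) → h i }) ,
                   ⊨-cong formula (λ { zero → Eq-refl ; (suc zero) → Eq-refl ; (suc (suc i)) → Eq-sym (h i) })
  open Template

  interpreted : ∀ {k} (G : Fm ℒR (suc k)) → Δ₀ᴾ G → Template k
  interpreted {k} G δ = record
    { formula = interpret G suc zero
    ; bounded = interpret-Δ δ
    ; local = λ ns a p h g → proj₂ (⟦interpret⟧ G λ _ → Eq-refl)
        (⟦⟧-local δ ns a (λ { zero → p ; (suc i) → h i }) (proj₁ (⟦interpret⟧ G λ _ → Eq-refl) g))
    }

  interpreted-holds : ∀ {k} (G : Fm ℒR (suc k)) (δ : Δ₀ᴾ G) {r y e} →
                      Holds (interpreted G δ) r y e ↔ ⟦ G ⟧ (Choice r) (y ∷ᵉ e)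
  interpreted-holds G δ = ⟦interpret⟧ G λ { zero → Eq-refl ; (suc i) → Eq-refl }

  unpack : ∀ {k} → Fin (suc (suc (suc (suc k)))) → Fin (suc (suc (suc (suc (suc (suc (suc k)))))))
  unpack zero                      = # 4
  unpack (suc zero)                = # 5
  unpack (suc (suc zero))          = # 2
  unpack (suc (suc (suc zero)))    = # 0
  unpack (suc (suc (suc (suc i)))) = suc (↑³ (↑³ i))

  unpack-≈ : ∀ {k b v a u r y} {e : Fin (suc k) → D} i →
             Eq ((b ∷ᵉ v ∷ᵉ a ∷ᵉ u ∷ᵉ r ∷ᵉ y ∷ᵉ e) (unpack i)) ((r ∷ᵉ y ∷ᵉ a ∷ᵉ b ∷ᵉ e ∘ suc) i)
  unpack-≈ zero                      = Eq-refl
  unpack-≈ (suc zero)                = Eq-refl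
  unpack-≈ (suc (suc zero))          = Eq-refl
  unpack-≈ (suc (suc (suc zero)))    = Eq-refl
  unpack-≈ (suc (suc (suc (suc i)))) = Eq-refl

  -- Two parameters become one Kuratowski pair. Its components are reached by bounded quantifiers
  -- and, by transitivity, lie in every nice set containing the pair, so locality survives.
  pack : ∀ {k} → Template (suc (suc k)) → Template (suc k)
  pack {k} T = record
    { formula = ∃∈ (# 2) (∃∈ (# 0) (∃∈ (# 4) (∃∈ (# 0) (kur (# 6) (# 2) (# 0) ∧̇ ren unpack (formula T)))))
    ; bounded = ∃∈-c _ (∃∈-c _ (∃∈-c _ (∃∈-c _ (∧-c (kur-Δ _ _ _) (Δ-ren (bounded T))))))
    ; local = λ {s} {e = e} ns ag y∈s h m k → m λ (u , u∈t , m) → m λ (a , a∈u , m) → m λ (v , v∈t , m) → m λ (b , b∈v , κ , g) →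
        let up : ∀ {x z} → x ε z → z ε e zero → x ε s
            up p q = proj₁ ns _ (proj₁ ns _ (h zero) _ q) _ p in
        k (u , u∈t , λ k → k (a , a∈u , λ k → k (v , v∈t , λ k → k (b , b∈v , κ ,
          proj₂ (⊨-ren (formula T) unpack-≈) (local T ns ag y∈s (up a∈u u∈t ∷ˢ up b∈v v∈t ∷ˢ h ∘ suc)
            (proj₁ (⊨-ren (formula T) unpack-≈) g))))))
    }

  pack-holds : ∀ {k} (T : Template (suc (suc k))) {t a b} {e : Fin k → D} → Kur t a b → ∀ r y →
               Holds (pack T) r y (t ∷ᵉ e) ↔ Holds T r y (a ∷ᵉ b ∷ᵉ e)
  pack-holds T {t} {a} {b} {e} κ r y =
    (λ m → ⊨-stable (formula T) λ k → m λ (u , _ , m) → m λ (a′ , _ , m) → m λ (v , _ , m) → m λ (b′ , _ , κ′ , g) →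
      Kur-injective κ′ κ λ (a≈ , b≈) → k (proj₁ (Holds-cong T λ { zero → a≈ ; (suc zero) → b≈ ; (suc (suc i)) → Eq-refl })
        (proj₁ (⊨-ren (formula T) unpack-≈) g))) ,
    (λ g k → κ λ (u , u∈t , m) → m λ (v , v∈t , du , dv , _) →
      k (u , u∈t , λ k → k (a , proj₁ du , λ k → k (v , v∈t , λ k → k (b , proj₁ (proj₂ dv) , κ ,
        proj₂ (⊨-ren (formula T) unpack-≈) g)))))

  packed : ∀ {k} → Template (suc k) → Template 1
  packed {zero}  T = T
  packed {suc k} T = packed (pack T)

  Codes : ∀ {k} → Template 1 → Template k → Set
  Codes {k} T S = ∀ (e : Fin k → D) → M (Σ D λ t → ∀ r y → Holds T r y (t ∷ᵉ []ᵉ) ↔ Holds S r y e)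

  packed-codes : ∀ {k} (T : Template (suc k)) → Codes (packed T) T
  packed-codes {zero}  T e k = k (e zero , λ r y → Holds-cong T λ { zero → Eq-refl })
  packed-codes {suc n} T e k = kur-∃ (e zero) (e (suc zero)) λ (p , κ) →
    packed-codes (pack T) (p ∷ᵉ λ i → e (suc (suc i))) λ (t , h) → k (t , λ r y → ↔-trans (h r y)
      (↔-trans (pack-holds T κ r y) (Holds-cong T λ { zero → Eq-refl ; (suc zero) → Eq-refl ; (suc (suc i)) → Eq-refl })))

  -- Filler for the axioms other than collection: it is never violated.
  never : Template 1
  never = record { formula = ¬̇ (# 0 ≐ # 0) ; bounded = ¬-c (≐-at _ _) ; local = λ _ _ _ _ f _ → f Eq-refl }

  skip : Fin 3 → Fin 4
  skip zero             = zero
  skip (suc zero)       = suc zero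
  skip (suc (suc zero)) = suc (suc (suc zero))

  skip-holds : ∀ (T : Template 1) {r y} {e : Fin 2 → D} → (r ∷ᵉ y ∷ᵉ e ⊨ ren skip (formula T)) ↔ Holds T r y (e ∘ suc)
  skip-holds T = ⊨-ren (formula T) λ { zero → Eq-refl ; (suc zero) → Eq-refl ; (suc (suc zero)) → Eq-refl }

  -- The first component of the code, empty or not, selects the summand.
  either : Template 1 → Template 1 → Template 2
  either S T = record
    { formula = (∀∈ (# 2) (¬̇ (# 0 ≐ # 0)) ∧̇ ren skip (formula S)) ∨̇ (∃∈ (# 2) (# 0 ≐ # 0) ∧̇ ren skip (formula T))
    ; bounded = ∨-c (∧-c (∀∈-c _ (¬-c (≐-at _ _))) (Δ-ren (bounded S))) (∧-c (∃∈-c _ (≐-at _ _)) (Δ-ren (bounded T)))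
    ; local = λ ns a p h m k → m λ
        { (inj₁ (c , g)) → k (inj₁ (c , proj₂ (skip-holds S) (local S ns a p (h ∘ suc) (proj₁ (skip-holds S) g))))
        ; (inj₂ (c , g)) → k (inj₂ (c , proj₂ (skip-holds T) (local T ns a p (h ∘ suc) (proj₁ (skip-holds T) g)))) }
    }

  infixr 5 _⊞_
  _⊞_ : Template 1 → Template 1 → Template 1
  S ⊞ T = pack (either S T)

  ⊞-codesˡ : ∀ S T → Codes (S ⊞ T) S
  ⊞-codesˡ S T e k = separation {φ = ¬̇ (# 0 ≐ # 0)} (¬-c (≐-at _ _)) point []ᵉ λ (∅ , h) →
    kur-∃ ∅ (e zero) λ (t , κ) → k (t , λ r y → ↔-trans (pack-holds (either S T) κ r y)
      ( (λ m → ⊨-stable (formula S) λ k → m λ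
          { (inj₁ (_ , g)) → k (proj₁ (Holds-cong S λ { zero → Eq-refl }) (proj₁ (skip-holds S) g))
          ; (inj₂ (m , _)) → m λ (x , p , _) → proj₂ (proj₁ (h x) p) Eq-refl })
      , λ g k → k (inj₁ ((λ x p → proj₂ (proj₁ (h x) p)) , proj₂ (skip-holds S) (proj₂ (Holds-cong S λ { zero → Eq-refl }) g)))))

  ⊞-codesʳ : ∀ S T → Codes (S ⊞ T) T
  ⊞-codesʳ S T e k = pairing point point λ (c , p∈c , _) →
    kur-∃ c (e zero) λ (t , κ) → k (t , λ r y → ↔-trans (pack-holds (either S T) κ r y)
      ( (λ m → ⊨-stable (formula T) λ k → m λ
          { (inj₁ (f , _)) → f point p∈c Eq-refl
          ; (inj₂ (_ , g)) → k (proj₁ (Holds-cong T λ { zero → Eq-refl }) (proj₁ (skip-holds T) g)) })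
      , λ g k → k (inj₂ ((λ k → k (point , p∈c , Eq-refl)) , proj₂ (skip-holds T) (proj₂ (Holds-cong T λ { zero → Eq-refl }) g)))))

  Codes-trans : ∀ {k} (R S : Template 1) (T : Template k) → Codes R S → Codes S T → Codes R T
  Codes-trans R S T c d e k = d e λ (t , h) → c (t ∷ᵉ []ᵉ) λ (u , h′) → k (u , λ r y → ↔-trans (h′ r y) (h r y))

  templateOf : ∀ {A} → KPᴾ+GAC A → Template 1
  templateOf (kp (coll n G δ)) = packed (interpreted G δ)
  templateOf _                 = never

  templateFor : ∀ {Γ} → All KPᴾ+GAC Γ → Template 1
  templateFor []         = never
  templateFor (ax ∷ axs) = templateOf ax ⊞ templateFor axs

  -- The template depends on the evidence that `A` is an axiom, so the evidence is returned with the
  -- coding.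
  templateFor-codes : ∀ {Γ} (axs : All KPᴾ+GAC Γ) {A} → A ∈ Γ → Σ (KPᴾ+GAC A) λ ax → Codes (templateFor axs) (templateOf ax)
  templateFor-codes (ax ∷ axs) (here refl) = ax , ⊞-codesˡ (templateOf ax) (templateFor axs)
  templateFor-codes (ax ∷ axs) (there i) with templateFor-codes axs i
  ... | ax′ , c = ax′ , Codes-trans (templateOf ax ⊞ templateFor axs) (templateFor axs) (templateOf ax′)
    (⊞-codesʳ (templateOf ax) (templateFor axs)) c

  promise : Template 1 → Promise 𝔐
  promise T = record
    { formula = formula T
    ; bounded = bounded T
    ; local = λ ns a p q → local T ns a p λ { zero → q }
    }

  module _ (T : Template 1) where
    open Forcing 𝔐 (promise T)
    open Generic 𝔐 holds (promise T)

    Force-axiom : ∀ {A} (ax : KPᴾ+GAC A) → Codes T (templateOf ax) → ∀ {p} → Cond p → Force A []ᵉ p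
    Force-axiom (kp extensionality) _ c = proj₂ (Force-embed extAx {[]ᵉ} c) (holds (kp extensionality))
    Force-axiom (kp pair)           _ c = proj₂ (Force-embed pairAx {[]ᵉ} c) (holds (kp pair))
    Force-axiom (kp union)          _ c = proj₂ (Force-embed unionAx {[]ᵉ} c) (holds (kp union))
    Force-axiom (kp inf)            _ c = proj₂ (Force-embed infAx {[]ᵉ} c) (holds (kp inf))
    Force-axiom (kp pow)            _ c = proj₂ (Force-embed powAx {[]ᵉ} c) (holds (kp pow))
    Force-axiom (kp (sep n φ δ))    _ c = Force-sep n φ δ
    Force-axiom (kp (coll n G δ))   h c = Force-coll n G δ λ e k →
      Codes-trans T (templateOf (KPᴾ+GAC.kp (coll n G δ))) (interpreted G δ) h (packed-codes (interpreted G δ)) e λ (t , h′) →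
        k (t , λ r y → ↔-trans (h′ r y) (interpreted-holds G δ))
    Force-axiom (kp (ind n φ))      _ c = Force-ind n φ
    Force-axiom gacFun              _ c = Force-gacFun c
    Force-axiom gacCh               _ c = Force-gacChoice c

    -- The initial condition forces the axioms used, hence `embed A`, and `Force-embed` reads this
    -- off in the model. `⊨-stable` absorbs the continuation under which that condition is given.
    conservative : ∀ {Γ} {A : Sentence ℒ∈} →
      (∀ {C} → C ∈ Γ → Σ (KPᴾ+GAC C) λ ax → Codes T (templateOf ax)) → Γ ⊢ embed A → []ᵉ ⊨ A
    conservative {A = A} axs d = ⊨-stable A λ k → initial λ (p , c) → k (proj₁ (Force-embed A c)
      (sound d c λ i → let ax , h = axs i in Force-axiom ax h c))

theorem3p2 : (A : Sentence ℒ∈) → Σᴾ A → KPᴾ+GAC ⊩ embed A → KPᴾ+AC ⊩ A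
theorem3p2 A _ (Γ , axs , d) = completeness KPᴾ+AC A λ 𝔐 holds →
  let open Promises 𝔐 holds in conservative (templateFor axs) (templateFor-codes axs) d
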